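{- As power series in $q$, $$\sum_{n=0}^{\infty}\sigma_{ed}\mathrm{moex}(n)\,q^n=\frac{(q^2;q^2)^2_{\infty}\,(q;q)^3_{\infty}}{(q^4;q^4)_{\infty}}$$ and $$\sum_{n=0}^{\infty}\sigma_{ed}\mathrm{meex}(n)\,q^n=2\,\frac{(-q^2;q^2)_{\infty}}{(q;q^2)_{\infty}}\,\sigma(q^2),$$ where $\sigma(q):=\sum_{n=0}^{\infty}\frac{q^{n(n+1)/2}}{(-q;q)_n}$.
   Context: Notation: $(a;q)_0:=1$, $(a;q)_n:=\prod_{k=0}^{n-1}(1-aq^k)$, $(a;q)_\infty:=\lim_{n\to\infty}(a;q)_n$. For $n\ge 0$, $\mathcal{P}_{ed}(n)$ is the set of all partitions of $n$ in which no even part is repeated (each even part appears at most once; odd parts may appear with any multiplicity). The empty partition is the unique element of $\mathcal{P}_{ed}(0)$. For $\lambda\in\mathcal{P}_{ed}(n)$, $\mathrm{moex}_{ed}(\lambda)$ (resp. $\mathrm{meex}_{ed}(\lambda)$) is the smallest positive odd (resp. positive even) integer that is not a part of $\lambda$. Define $$\sigma_{ed}\mathrm{moex}(n):=\sum_{\lambda\in\mathcal{P}_{ed}(n)}\mathrm{moex}_{ed}(\lambda),\qquad \sigma_{ed}\mathrm{meex}(n):=\sum_{\lambda\in\mathcal{P}_{ed}(n)}\mathrm{meex}_{ed}(\lambda).$$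
   Formalization: The first identity is proved with (-q;q)_∞^3 in place of the printed (q;q)_∞^3, which is false: at q^1 the left side has coefficient 3 and the printed right side has −3. The second identity is as printed. -}

module Defs where

open import Data.Nat.Base as ℕ using (ℕ; zero; suc; _∸_; _⊓_; _≤_; _<_; _≥_; z≤n; s≤s)
import Data.Nat.Properties as ℕ
open import Data.Nat.Divisibility using (_∣_; _∣?_; m∣m*n; ∣m+n∣m⇒∣n; ∣m∣n⇒∣m+n; ∣1⇒≡1; ∣-refl)
open import Data.Nat.DivMod using (_/_; m*n/n≡m; /-mono-≤)
open import Data.Nat.ListAction using (sum)
open import Data.Integer.Base using (ℤ; +_; 0ℤ; 1ℤ; -_; _+_; _*_; _-_)
import Data.Integer.Properties as ℤ
open import Data.Integer.Tactic.RingSolver using (solve-∀)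
open import Data.List.Base using (List; []; _∷_; map; filter; length; upTo; concatMap)
open import Data.List.Membership.Propositional using (_∈_; _∉_; find; lose)
open import Data.List.Membership.Propositional.Properties using (∈-map⁺; ∈-map⁻; ∈-concatMap⁺; ∈-concatMap⁻; ∈-upTo⁺; ∈-upTo⁻; ∈-filter⁺; ∈-filter⁻)
open import Data.List.Membership.DecPropositional ℕ._≟_ using (_∈?_)
open import Data.List.Properties using (∷-injectiveˡ; ∷-injectiveʳ)
open import Data.List.Relation.Unary.All as All using (All; []; _∷_)
import Data.List.Relation.Unary.All.Properties as All
import Data.List.Relation.Unary.AllPairs as AllPairs
import Data.List.Relation.Unary.AllPairs.Properties as AllPairs
open import Data.List.Relation.Unary.Any using (here; there)
open import Data.List.Relation.Unary.Linked using (Linked; []; [-]; _∷_)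
open import Data.List.Relation.Unary.Unique.Propositional using (Unique)
import Data.List.Relation.Unary.Unique.Propositional.Properties as Unique
open import Data.Product.Base using (∃; _×_; _,_; proj₂)
open import Function.Base using (_∘_)
open import Function.Bundles using (_⇔_; mk⇔; Equivalence)
open import Relation.Binary.PropositionalEquality using (_≡_; _≢_; refl; sym; trans; cong; cong₂; subst; module ≡-Reasoning)
open import Relation.Nullary using (¬_; yes; no; ¬?; contradiction; _×-dec_; _→-dec_)
open import Relation.Unary using (Pred; Decidable)
open import Level using (0ℓ)

------------------------------------------------------------------------
-- Formal power series over ℤ, as coefficient sequences

Series : Set
Series = ℕ → ℤ

infix  4 _≈_
infixl 6 _⊕_
infixl 7 _⊗_ _⊘_
infix  8 ⊖_
infixl 9 _^_

_≈_ : Series → Series → Set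
f ≈ g = ∀ n → f n ≡ g n

∑< : ℕ → (ℕ → ℤ) → ℤ
∑< zero    f = 0ℤ
∑< (suc n) f = ∑< n f + f n

const : ℤ → Series
const c zero    = c
const c (suc _) = 0ℤ

one : Series
one = const 1ℤ

q : Series
q zero          = 0ℤ
q (suc zero)    = 1ℤ
q (suc (suc _)) = 0ℤ

_⊕_ : Series → Series → Series
(f ⊕ g) n = f n + g n

⊖_ : Series → Series
(⊖ f) n = - f n

_⊗_ : Series → Series → Series
(f ⊗ g) n = ∑< (suc n) (λ i → f i * g (n ∸ i))

_^_ : Series → ℕ → Series
f ^ zero  = one
f ^ suc n = (f ^ n) ⊗ f

partialSum : (ℕ → Series) → ℕ → Series
partialSum t N n = ∑< N (λ k → t k n)

-- The limit of the partial sums whenever t k = O(q^k) for every k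
-- (∑∞-converges): the terms t k with k > n do not affect the n-th coefficient.
∑∞ : (ℕ → Series) → Series
∑∞ t n = partialSum t (suc n) n

-- 1/g as the geometric series ∑ (1 - g)^k; meaningful when g has constant
-- coefficient 1 (recip-inverse).
recip : Series → Series
recip g = ∑∞ (λ k → (one ⊕ (⊖ g)) ^ k)

_⊘_ : Series → Series → Series
f ⊘ g = f ⊗ recip g

-- (a;b)_n
⟨_⨾_⟩_ : Series → Series → ℕ → Series
⟨ a ⨾ b ⟩ zero  = one
⟨ a ⨾ b ⟩ suc n = (⟨ a ⨾ b ⟩ n) ⊗ (one ⊕ (⊖ (a ⊗ b ^ n)))

-- (a;b)_∞, the limit of (a;b)_n whenever a and b have constant coefficient 0
-- (⟨⟩∞-converges): the factors with k ≥ n are 1 + O(q^(n+1)).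
⟨_⨾_⟩∞ : Series → Series → Series
⟨ a ⨾ b ⟩∞ n = (⟨ a ⨾ b ⟩ n) n

σ-term : Series → ℕ → Series
σ-term x n = x ^ (n ℕ.* suc n / 2) ⊘ (⟨ ⊖ x ⨾ x ⟩ n)

-- σ(x) for a series x with constant coefficient 0, so that σ(q²) is σ (q ^ 2).
σ : Series → Series
σ x = ∑∞ (σ-term x)

------------------------------------------------------------------------
-- Partitions, as weakly decreasing lists of positive parts

record IsPartition (n : ℕ) (λs : List ℕ) : Set where
  constructor isPartition
  field
    decreasing : Linked _≥_ λs
    positive   : All (0 <_) λs
    total      : sum λs ≡ n

multiplicity : ℕ → List ℕ → ℕ
multiplicity d λs = length (filter (d ℕ.≟_) λs)

NoRepeatedEven : Pred (List ℕ) 0ℓ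
NoRepeatedEven λs = All (λ d → 2 ∣ d → multiplicity d λs ≤ 1) λs

noRepeatedEven? : Decidable NoRepeatedEven
noRepeatedEven? λs = All.all? (λ d → (2 ∣? d) →-dec (multiplicity d λs ℕ.≤? 1)) λs

-- Partitions of n into parts ≤ m, the first argument bounding the number of parts.
partitionsWithin : ℕ → ℕ → ℕ → List (List ℕ)
partitionsWithin _       m zero    = [] ∷ []
partitionsWithin zero    m (suc n) = []
partitionsWithin (suc l) m (suc n) =
  concatMap (λ p → map (suc p ∷_) (partitionsWithin l (suc p) (n ∸ p))) (upTo (m ⊓ suc n))

partitions : ℕ → List (List ℕ)
partitions n = partitionsWithin n n n

𝒫ed : ℕ → List (List ℕ)
𝒫ed n = filter noRepeatedEven? (partitions n)

------------------------------------------------------------------------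
-- Minimal excludants

Least : Pred ℕ 0ℓ → Pred ℕ 0ℓ
Least P d = P d × (∀ e → P e → d ≤ e)

-- The least d ≤ b with P d, if there is one.
least≤ : {P : Pred ℕ 0ℓ} → Decidable P → ℕ → ℕ
least≤ P? zero    = zero
least≤ P? (suc b) with P? zero
... | yes _ = zero
... | no  _ = suc (least≤ (P? ∘ suc) b)

MissingOdd : List ℕ → Pred ℕ 0ℓ
MissingOdd λs d = 0 < d × ¬ (2 ∣ d) × d ∉ λs

MissingEven : List ℕ → Pred ℕ 0ℓ
MissingEven λs d = 0 < d × 2 ∣ d × d ∉ λs

missingOdd? : ∀ λs → Decidable (MissingOdd λs)
missingOdd? λs d = (0 ℕ.<? d) ×-dec (¬? (2 ∣? d) ×-dec ¬? (d ∈? λs))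

missingEven? : ∀ λs → Decidable (MissingEven λs)
missingEven? λs d = (0 ℕ.<? d) ×-dec ((2 ∣? d) ×-dec ¬? (d ∈? λs))

-- The search bounds exceed every part of λs.
moex : List ℕ → ℕ
moex λs = least≤ (missingOdd? λs) (2 ℕ.* sum λs ℕ.+ 1)

meex : List ℕ → ℕ
meex λs = least≤ (missingEven? λs) (2 ℕ.* sum λs ℕ.+ 2)

σmoex : ℕ → ℕ
σmoex n = sum (map moex (𝒫ed n))

σmeex : ℕ → ℕ
σmeex n = sum (map meex (𝒫ed n))

------------------------------------------------------------------------
-- Adequacy of the power series operations

infix 4 _⟶_

-- Convergence in the q-adic topology.
_⟶_ : (ℕ → Series) → Series → Set
F ⟶ f = ∀ n → ∃ λ N → ∀ m → N ≤ m → F m n ≡ f n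

-- f = O(q^k)
Order≥ : ℕ → Series → Set
Order≥ k f = ∀ i → i < k → f i ≡ 0ℤ

∑<-cong : ∀ n {f g : ℕ → ℤ} → (∀ i → i < n → f i ≡ g i) → ∑< n f ≡ ∑< n g
∑<-cong zero    eq = refl
∑<-cong (suc n) eq =
  cong₂ _+_ (∑<-cong n (λ i i<n → eq i (ℕ.m<n⇒m<1+n i<n))) (eq n (ℕ.n<1+n n))

∑<-zero : ∀ n {f : ℕ → ℤ} → (∀ i → i < n → f i ≡ 0ℤ) → ∑< n f ≡ 0ℤ
∑<-zero zero    eq = refl
∑<-zero (suc n) eq =
  cong₂ _+_ (∑<-zero n (λ i i<n → eq i (ℕ.m<n⇒m<1+n i<n))) (eq n (ℕ.n<1+n n))

∑<-distrib-+ : ∀ n (f g : ℕ → ℤ) → ∑< n (λ i → f i + g i) ≡ ∑< n f + ∑< n g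
∑<-distrib-+ zero    f g = refl
∑<-distrib-+ (suc n) f g =
  trans (cong (_+ (f n + g n)) (∑<-distrib-+ n f g)) (interchange (∑< n f) (∑< n g) (f n) (g n))
  where
  interchange : ∀ a b c d → (a + b) + (c + d) ≡ (a + c) + (b + d)
  interchange = solve-∀

⊗-Order≥ : ∀ {j k f g} → Order≥ j f → Order≥ k g → Order≥ (j ℕ.+ k) (f ⊗ g)
⊗-Order≥ {j} {k} {f} {g} of og n n<j+k = ∑<-zero (suc n) term
  where
  term : ∀ i → i < suc n → f i * g (n ∸ i) ≡ 0ℤ
  term i i≤n with i ℕ.<? j
  ... | yes i<j = cong (_* g (n ∸ i)) (of i i<j)
  ... | no  i≮j = trans (cong (f i *_) (og (n ∸ i) n∸i<k)) (ℤ.*-zeroʳ (f i))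
    where
    n∸i<k : n ∸ i < k
    n∸i<k = ℕ.+-cancelˡ-< i _ _ (subst (_< i ℕ.+ k) (sym (ℕ.m+[n∸m]≡n (ℕ.≤-pred i≤n)))
              (ℕ.<-≤-trans n<j+k (ℕ.+-monoˡ-≤ k (ℕ.≮⇒≥ i≮j))))

Order≥1 : ∀ {f} → f 0 ≡ 0ℤ → Order≥ 1 f
Order≥1 f0 zero    _        = f0
Order≥1 f0 (suc i) (s≤s ())

^-Order≥ : ∀ {f} → f 0 ≡ 0ℤ → ∀ n → Order≥ n (f ^ n)
^-Order≥ f0 zero    i ()
^-Order≥ {f} f0 (suc n) i i<1+n =
  ⊗-Order≥ {n} {1} {f ^ n} {f} (^-Order≥ f0 n) (Order≥1 f0) i (subst (i <_) (ℕ.+-comm 1 n) i<1+n)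

partialSum-stable : ∀ {t} → (∀ k → Order≥ k (t k)) →
                    ∀ n d → partialSum t (d ℕ.+ suc n) n ≡ ∑∞ t n
partialSum-stable ot n zero    = refl
partialSum-stable ot n (suc d) =
  trans (cong₂ _+_ (partialSum-stable ot n d) (ot (d ℕ.+ suc n) n (ℕ.m≤n+m (suc n) d)))
        (ℤ.+-identityʳ _)

∑∞-converges : ∀ {t} → (∀ k → Order≥ k (t k)) → partialSum t ⟶ ∑∞ t
∑∞-converges {t} ot n = suc n , λ m n<m →
  subst (λ m → partialSum t m n ≡ ∑∞ t n) (ℕ.m∸n+n≡m n<m) (partialSum-stable ot n (m ∸ suc n))

⊗-identityʳ : ∀ f → f ⊗ one ≈ f
⊗-identityʳ f n =
  trans (cong₂ _+_ (∑<-zero n below) top) (ℤ.+-identityˡ _)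
  where
  below : ∀ i → i < n → f i * one (n ∸ i) ≡ 0ℤ
  below i i<n with n ∸ i | ℕ.m<n⇒0<n∸m i<n
  ... | suc _ | _ = ℤ.*-zeroʳ (f i)
  top : f n * one (n ∸ n) ≡ f n
  top rewrite ℕ.n∸n≡0 n = ℤ.*-identityʳ (f n)

⊗-distribˡ : ∀ f g h → f ⊗ (g ⊕ h) ≈ (f ⊗ g) ⊕ (f ⊗ h)
⊗-distribˡ f g h n =
  trans (∑<-cong (suc n) (λ i _ → ℤ.*-distribˡ-+ (f i) (g (n ∸ i)) (h (n ∸ i))))
        (∑<-distrib-+ (suc n) (λ i → f i * g (n ∸ i)) (λ i → f i * h (n ∸ i)))

⊗-distribʳ : ∀ f g h → (g ⊕ h) ⊗ f ≈ (g ⊗ f) ⊕ (h ⊗ f)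
⊗-distribʳ f g h n =
  trans (∑<-cong (suc n) (λ i _ → ℤ.*-distribʳ-+ (f (n ∸ i)) (g i) (h i)))
        (∑<-distrib-+ (suc n) (λ i → g i * f (n ∸ i)) (λ i → h i * f (n ∸ i)))

⊗-constant : ∀ f g → (f ⊗ g) 0 ≡ f 0 * g 0
⊗-constant f g = ℤ.+-identityˡ _

⊗-1+O : ∀ {f g n} → Order≥ (suc n) g → (f ⊗ (one ⊕ g)) n ≡ f n
⊗-1+O {f} {g} {n} og =
  trans (⊗-distribˡ f one g n)
        (trans (cong₂ _+_ (⊗-identityʳ f n) (⊗-Order≥ {0} {suc n} {f} {g} (λ _ ()) og n (ℕ.n<1+n n)))
               (ℤ.+-identityʳ _))

⟨⟩-stable : ∀ {a b} → a 0 ≡ 0ℤ → b 0 ≡ 0ℤ →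
            ∀ n d → (⟨ a ⨾ b ⟩ (d ℕ.+ n)) n ≡ ⟨ a ⨾ b ⟩∞ n
⟨⟩-stable         a0 b0 n zero    = refl
⟨⟩-stable {a} {b} a0 b0 n (suc d) =
  trans (⊗-1+O {⟨ a ⨾ b ⟩ (d ℕ.+ n)} {⊖ (a ⊗ b ^ (d ℕ.+ n))} small) (⟨⟩-stable a0 b0 n d)
  where
  small : Order≥ (suc n) (⊖ (a ⊗ b ^ (d ℕ.+ n)))
  small i i≤n = cong -_ (⊗-Order≥ {1} {d ℕ.+ n} {a} {b ^ (d ℕ.+ n)} (Order≥1 a0) (^-Order≥ {b} b0 (d ℕ.+ n)) i
                  (ℕ.<-≤-trans i≤n (s≤s (ℕ.m≤n+m n d))))

⟨⟩∞-converges : ∀ {a b} → a 0 ≡ 0ℤ → b 0 ≡ 0ℤ → (⟨ a ⨾ b ⟩_) ⟶ ⟨ a ⨾ b ⟩∞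
⟨⟩∞-converges {a} {b} a0 b0 n = n , λ m n≤m →
  subst (λ m → (⟨ a ⨾ b ⟩ m) n ≡ ⟨ a ⨾ b ⟩∞ n) (ℕ.m∸n+n≡m n≤m) (⟨⟩-stable a0 b0 n (m ∸ n))

⟨⟩-constant : ∀ {a} b → a 0 ≡ 0ℤ → ∀ n → (⟨ a ⨾ b ⟩ n) 0 ≡ 1ℤ
⟨⟩-constant     b a0 zero    = refl
⟨⟩-constant {a} b a0 (suc n) =
  trans (⊗-1+O {⟨ a ⨾ b ⟩ n} {⊖ (a ⊗ b ^ n)} small) (⟨⟩-constant b a0 n)
  where
  small : Order≥ 1 (⊖ (a ⊗ b ^ n))
  small i i<1 = cong -_ (⊗-Order≥ {1} {0} {a} {b ^ n} (Order≥1 a0) (λ _ ()) i i<1)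

⟨⟩∞-constant : ∀ a b → ⟨ a ⨾ b ⟩∞ 0 ≡ 1ℤ
⟨⟩∞-constant a b = refl

recip-inverse : ∀ g → g 0 ≡ 1ℤ → recip g ⊗ g ≈ one
recip-inverse g g0 n = begin
  (recip g ⊗ g) n                     ≡⟨ ∑<-cong (suc n) (λ i i≤n → cong (_* g (n ∸ i)) (truncate i (ℕ.≤-pred i≤n))) ⟩
  (partialSum (h ^_) (suc n) ⊗ g) n   ≡⟨ telescope (suc n) n ⟩
  one n - (h ^ suc n) n               ≡⟨ cong (λ c → one n - c) (^-Order≥ h0 (suc n) n (ℕ.n<1+n n)) ⟩
  one n - 0ℤ                          ≡⟨ ℤ.+-identityʳ _ ⟩
  one n                               ∎
  where
  open ≡-Reasoning
  h : Series
  h = one ⊕ (⊖ g)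

  h0 : h 0 ≡ 0ℤ
  h0 = cong (λ c → 1ℤ - c) g0

  truncate : ∀ i → i ≤ n → recip g i ≡ partialSum (h ^_) (suc n) i
  truncate i i≤n = sym (proj₂ (∑∞-converges {h ^_} (^-Order≥ h0) i) (suc n) (s≤s i≤n))

  split : ∀ f n → (f ⊗ g) n ≡ f n - (f ⊗ h) n
  split f n = begin
    (f ⊗ g) n                               ≡⟨ cancel ((f ⊗ g) n) ((f ⊗ h) n) ⟩
    ((f ⊗ g) n + (f ⊗ h) n) - (f ⊗ h) n     ≡⟨ cong (_- (f ⊗ h) n) (⊗-distribˡ f g h n) ⟨
    (f ⊗ (g ⊕ h)) n - (f ⊗ h) n             ≡⟨ cong (_- (f ⊗ h) n) (∑<-cong (suc n) (λ i _ → cong (f i *_) (g+h (g (n ∸ i)) (one (n ∸ i))))) ⟩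
    (f ⊗ one) n - (f ⊗ h) n                 ≡⟨ cong (_- (f ⊗ h) n) (⊗-identityʳ f n) ⟩
    f n - (f ⊗ h) n                         ∎
    where
    cancel : ∀ a b → a ≡ (a + b) - b
    cancel = solve-∀
    g+h : ∀ a b → a + (b - a) ≡ b
    g+h = solve-∀

  telescope : ∀ N n → (partialSum (h ^_) N ⊗ g) n ≡ one n - (h ^ N) n
  telescope zero    n = trans (∑<-zero (suc n) (λ i _ → refl)) (sym (ℤ.+-inverseʳ (one n)))
  telescope (suc N) n = begin
    (partialSum (h ^_) (suc N) ⊗ g) n                  ≡⟨ ⊗-distribʳ g (partialSum (h ^_) N) (h ^ N) n ⟩
    (partialSum (h ^_) N ⊗ g) n + (h ^ N ⊗ g) n        ≡⟨ cong₂ _+_ (telescope N n) (split (h ^ N) n) ⟩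
    (one n - (h ^ N) n) + ((h ^ N) n - (h ^ suc N) n)  ≡⟨ cancel (one n) ((h ^ N) n) ((h ^ suc N) n) ⟩
    one n - (h ^ suc N) n                              ∎
    where
    cancel : ∀ a b c → (a - b) + (b - c) ≡ a - c
    cancel = solve-∀

σ-converges : ∀ {x} → x 0 ≡ 0ℤ → partialSum (σ-term x) ⟶ σ x
σ-converges {x} x0 = ∑∞-converges {σ-term x} λ k i i<k →
  ⊗-Order≥ {k ℕ.* suc k / 2} {0} {x ^ (k ℕ.* suc k / 2)} {recip (⟨ ⊖ x ⨾ x ⟩ k)} (^-Order≥ {x} x0 (k ℕ.* suc k / 2)) (λ _ ()) i
    (ℕ.<-≤-trans i<k (subst (k ≤_) (sym (ℕ.+-identityʳ _)) (k≤k[k+1]/2 k)))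
  where
  k≤k[k+1]/2 : ∀ k → k ≤ k ℕ.* suc k / 2
  k≤k[k+1]/2 zero    = z≤n
  k≤k[k+1]/2 (suc k) = subst (_≤ suc k ℕ.* suc (suc k) / 2) (m*n/n≡m (suc k) 2)
    (/-mono-≤ (ℕ.*-monoʳ-≤ (suc k) {2} {suc (suc k)} (s≤s (s≤s z≤n))) (ℕ.≤-refl {2}))

------------------------------------------------------------------------
-- Adequacy of the enumeration of partitions

∈-partitionsWithin⁻ : ∀ l m n {λs} → λs ∈ partitionsWithin l m n →
                      Linked _≥_ (m ∷ λs) × All (0 <_) λs × sum λs ≡ n
∈-partitionsWithin⁻ _       m zero    (here refl) = [-] , [] , refl
∈-partitionsWithin⁻ zero    m (suc n) ()
∈-partitionsWithin⁻ (suc l) m (suc n) λs∈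
  with find (∈-concatMap⁻ (λ p → map (suc p ∷_) (partitionsWithin l (suc p) (n ∸ p))) {xs = upTo (m ⊓ suc n)} λs∈)
... | p , p∈ , λs∈′ with ∈-map⁻ (suc p ∷_) λs∈′
... | μs , μs∈ , refl with ∈-partitionsWithin⁻ l (suc p) (n ∸ p) μs∈
... | dec , pos , tot =
  ℕ.≤-trans p< (ℕ.m⊓n≤m m (suc n)) ∷ dec , s≤s z≤n ∷ pos ,
  cong suc (trans (cong (p ℕ.+_) tot) (ℕ.m+[n∸m]≡n (ℕ.≤-pred (ℕ.≤-trans p< (ℕ.m⊓n≤n m (suc n))))))
  where
  p< : p < m ⊓ suc n
  p< = ∈-upTo⁻ p∈

∈-partitionsWithin⁺ : ∀ l m n {λs} → n ≤ l →
                      Linked _≥_ (m ∷ λs) → All (0 <_) λs → sum λs ≡ n →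
                      λs ∈ partitionsWithin l m n
∈-partitionsWithin⁺ l m zero {[]}         _ _ _         _  = here refl
∈-partitionsWithin⁺ l m zero {zero  ∷ _}  _ _ (() ∷ _)  _
∈-partitionsWithin⁺ l m zero {suc _ ∷ _}  _ _ _         ()
∈-partitionsWithin⁺ l m (suc n) {[]}      _ _ _         ()
∈-partitionsWithin⁺ l m (suc n) {zero ∷ _} _ _ (() ∷ _) _
∈-partitionsWithin⁺ (suc l) m (suc n) {suc p ∷ μs} (s≤s n≤l) (m≥p ∷ dec) (_ ∷ pos) tot =
  ∈-concatMap⁺ (λ p → map (suc p ∷_) (partitionsWithin l (suc p) (n ∸ p)))
    (lose (∈-upTo⁺ (ℕ.⊓-glb m≥p (s≤s p≤n)))
      (∈-map⁺ (suc p ∷_) (∈-partitionsWithin⁺ l (suc p) (n ∸ p) (ℕ.≤-trans (ℕ.m∸n≤m n p) n≤l) dec pos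
        (trans (sym (ℕ.m+n∸m≡n p (sum μs))) (cong (_∸ p) tot′)))))
  where
  tot′ : p ℕ.+ sum μs ≡ n
  tot′ = ℕ.suc-injective tot
  p≤n : p ≤ n
  p≤n = subst (p ≤_) tot′ (ℕ.m≤m+n p (sum μs))

partitionsWithin-unique : ∀ l m n → Unique (partitionsWithin l m n)
partitionsWithin-unique _       m zero    = [] AllPairs.∷ AllPairs.[]
partitionsWithin-unique zero    m (suc n) = AllPairs.[]
partitionsWithin-unique (suc l) m (suc n) =
  Unique.concat⁺
    (All.map⁺ (All.universal (λ p → Unique.map⁺ ∷-injectiveʳ (partitionsWithin-unique l (suc p) (n ∸ p))) _))
    (AllPairs.map⁺ (AllPairs.map disjoint (Unique.upTo⁺ (m ⊓ suc n))))
  where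
  disjoint : ∀ {p p′} → p ≢ p′ → ∀ {λs} →
             ¬ (λs ∈ map (suc p ∷_) (partitionsWithin l (suc p) (n ∸ p)) ×
                λs ∈ map (suc p′ ∷_) (partitionsWithin l (suc p′) (n ∸ p′)))
  disjoint p≢p′ (∈₁ , ∈₂) with ∈-map⁻ _ ∈₁ | ∈-map⁻ _ ∈₂
  ... | _ , _ , refl | _ , _ , eq = p≢p′ (ℕ.suc-injective (∷-injectiveˡ eq))

∈-partitions : ∀ n λs → λs ∈ partitions n ⇔ IsPartition n λs
∈-partitions n λs = mk⇔ to from
  where
  tail : ∀ {m μs} → Linked _≥_ (m ∷ μs) → Linked _≥_ μs
  tail [-]       = []
  tail (_ ∷ dec) = dec

  to : λs ∈ partitions n → IsPartition n λs
  to λs∈ with ∈-partitionsWithin⁻ n n n λs∈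
  ... | dec , pos , tot = isPartition (tail dec) pos tot

  cons : ∀ {μs} → Linked _≥_ μs → sum μs ≡ n → Linked _≥_ (n ∷ μs)
  cons {[]}     dec tot = [-]
  cons {p ∷ μs} dec tot = subst (p ≤_) tot (ℕ.m≤m+n p (sum μs)) ∷ dec

  from : IsPartition n λs → λs ∈ partitions n
  from (isPartition dec pos tot) = ∈-partitionsWithin⁺ n n n ℕ.≤-refl (cons dec tot) pos tot

∈-𝒫ed : ∀ n λs → λs ∈ 𝒫ed n ⇔ (IsPartition n λs × NoRepeatedEven λs)
∈-𝒫ed n λs = mk⇔
  (λ λs∈ → let λs∈′ , ed = ∈-filter⁻ noRepeatedEven? λs∈ in Equivalence.to (∈-partitions n λs) λs∈′ , ed)
  (λ (part , ed) → ∈-filter⁺ noRepeatedEven? (Equivalence.from (∈-partitions n λs) part) ed)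

𝒫ed-unique : ∀ n → Unique (𝒫ed n)
𝒫ed-unique n = Unique.filter⁺ noRepeatedEven? (partitionsWithin-unique n n n)

------------------------------------------------------------------------
-- Adequacy of the minimal excludants

least≤-least : ∀ {P : Pred ℕ 0ℓ} (P? : Decidable P) b → P b → Least P (least≤ P? b)
least≤-least P? zero    Pb = Pb , λ _ _ → z≤n
least≤-least {P} P? (suc b) Pb with P? zero
... | yes P0 = P0 , λ _ _ → z≤n
... | no ¬P0 with least≤-least {P ∘ suc} (P? ∘ suc) b Pb
...   | Pd , min = Pd , λ { zero P0 → contradiction P0 ¬P0 ; (suc e) Pe → s≤s (min e Pe) }

∈⇒≤sum : ∀ {d λs} → d ∈ λs → d ≤ sum λs
∈⇒≤sum {λs = _ ∷ μs} (here refl) = ℕ.m≤m+n _ (sum μs)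
∈⇒≤sum {λs = p ∷ _}  (there d∈)  = ℕ.≤-trans (∈⇒≤sum d∈) (ℕ.m≤n+m _ p)

2sum+1+k∉ : ∀ λs k → 2 ℕ.* sum λs ℕ.+ suc k ∉ λs
2sum+1+k∉ λs k d∈ = ℕ.<⇒≱ (ℕ.m<m+n (2 ℕ.* sum λs) (s≤s z≤n))
  (ℕ.≤-trans (∈⇒≤sum d∈) (ℕ.m≤m+n (sum λs) _))

moex-least : ∀ λs → Least (MissingOdd λs) (moex λs)
moex-least λs = least≤-least (missingOdd? λs) (2 ℕ.* sum λs ℕ.+ 1)
  ( ℕ.<-≤-trans (s≤s z≤n) (ℕ.m≤n+m 1 (2 ℕ.* sum λs))
  , (λ 2∣ → contradiction (∣1⇒≡1 (∣m+n∣m⇒∣n 2∣ (m∣m*n (sum λs)))) (λ ()))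
  , 2sum+1+k∉ λs 0 )

meex-least : ∀ λs → Least (MissingEven λs) (meex λs)
meex-least λs = least≤-least (missingEven? λs) (2 ℕ.* sum λs ℕ.+ 2)
  ( ℕ.<-≤-trans (s≤s z≤n) (ℕ.m≤n+m 2 (2 ℕ.* sum λs))
  , ∣m∣n⇒∣m+n (m∣m*n (sum λs)) ∣-refl
  , 2sum+1+k∉ λs 1 )

{-# OPTIONS --safe #-}

-- Every odd excludant 2r + 1 equals 1 + ∑_{1 ≤ k ≤ r} 2, and k ≤ r means that 1, 3, …, 2k - 1 are all
-- parts; similarly an even excludant 2r + 2 equals ∑_{0 ≤ k ≤ r} 2, and k ≤ r means that 2, 4, …, 2k are
-- all parts. The partitions satisfying such a condition are counted by a product over the parts, so that
--   ∑ σmoex(n) q^n = (-q²;q²)_∞ / (q;q²)_∞ · (1 + 2 ∑_{k ≥ 1} q^(k²)),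
--   ∑ σmeex(n) q^n = 2 / (q;q²)_∞ · ∑_{k ≥ 0} q^(k(k+1)) ∏_{j > k} (1 + q^(2j)).
-- The second is the claim. In the first, the square series equals (q²;q²)_∞ (-q;q²)_∞² by Gauss: for
-- Gaussian binomials in base q², the two Pascal rules give
--   ∑_{a + b = 2n} q^((a - n)²) [2n, a] = ∏_{i < n} (1 + q^(2i+1))²,
-- and [2n, a] tends to 1 / (q²;q²)_∞. Euler's (q;q²)_∞ (-q;q)_∞ = 1 finishes the proof.
-- All identities are proved modulo q^K, where infinite products and sums may be truncated.
module Submission where

open import Defs
open import Algebra.Bundles using (CommutativeRing)
import Algebra.Solver.CommutativeMonoid as MonoidSolver
import Algebra.Solver.Ring as RingSolver
open import Algebra.Solver.Ring.AlmostCommutativeRing using (_-Raw-AlmostCommutative⟶_; Induced-equivalence; fromCommutativeRing)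
open import Data.Bool.Base using (Bool; true; false; if_then_else_)
open import Data.Integer.Base using (ℤ; +_; 0ℤ; 1ℤ; -_; _+_; _*_; +-*-rawRing)
import Data.Integer.Properties as ℤ
open import Data.Integer.Tactic.RingSolver using (solve-∀)
open import Data.List.Base using (List; []; _∷_; _++_; length; map; filter; replicate; upTo; concatMap)
open import Data.List.Membership.Propositional using (_∈_; _∉_; find)
open import Data.List.Properties using (concatMap-cong; concatMap-++; filter-accept; filter-reject; ++-identityʳ; upTo-∷ʳ)
open import Data.List.Relation.Unary.All as All using (All; []; _∷_)
import Data.List.Relation.Unary.All.Properties as All
open import Data.List.Relation.Unary.Any using (here; there)
open import Data.List.Relation.Unary.Linked using (Linked; [-]; _∷_)
import Data.Maybe.Base as Maybe
open import Data.Nat.Base as ℕ using (ℕ; zero; suc; _∸_; _⊓_; _≤_; _<_; _≥_; z≤n; s≤s; ∣_-_∣)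
open import Data.Nat.Divisibility using (_∣_; _∣?_; divides; m∣m*n; ∣m+n∣m⇒∣n; ∣m∣n⇒∣m+n; ∣1⇒≡1)
open import Data.Nat.DivMod using (_/_; m*[n/m]≡n)
open import Data.Nat.Induction using (<-rec)
open import Data.Nat.ListAction using (sum)
import Data.Nat.Properties as ℕ
import Data.Nat.Tactic.RingSolver as ℕ-Solver
open import Data.List.Membership.DecPropositional ℕ._≟_ using (_∈?_)
open import Data.Product.Base using (∃; _×_; _,_; proj₁; proj₂)
open import Function.Base using (_∘_)
open import Function.Bundles using (_⇔_; mk⇔)
open import Level using (0ℓ)
open import Relation.Binary.Definitions using (WeaklyDecidable)
open import Relation.Binary.PropositionalEquality using (_≡_; _≢_; refl; sym; trans; cong; cong₂; subst; module ≡-Reasoning)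
open import Relation.Nullary using (Dec; ¬_; ¬?; yes; no; does; contradiction; _×-dec_; _→-dec_)
open import Relation.Nullary.Decidable using (dec-true; dec-false; dec⇒maybe; decidable-stable; does-⇔)
open import Relation.Unary using (Pred; Decidable)

-- The ring of power series modulo q^K

-- The cube in the first identity is (-q;q)_∞³. One factor is 1/(q;q²)_∞ by Euler; each of Gauss's
-- two factors (-q;q²)_∞ absorbs a factor (-q²;q²)_∞, one from the even parts and one from clearing
-- (q⁴;q⁴)_∞ = (q²;q²)_∞ (-q²;q²)_∞. The sign is forced: the only partition of 1 has odd excludant
-- 3, so the coefficient of q is 3, as in (-q;q)_∞³, whereas (q;q)_∞³ has -3. In the counting,
-- deleting one copy of the largest part p leaves a partition in which p may occur again, so the
-- weight attached to p does not factor off at once. The induction therefore remembers how many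
-- copies have been deleted, and the series of p is replaced by its tails. In Gauss's sum the
-- Gaussian binomials do not approach their limit uniformly: those with a or b small stay away from
-- it. There (a - n)² is large, and n = 2K is enough to make these terms vanish modulo q^K.

∑<-head : ∀ n (f : ℕ → ℤ) → ∑< (suc n) f ≡ f 0 + ∑< n (f ∘ suc)
∑<-head zero    f = ℤ.+-comm 0ℤ (f 0)
∑<-head (suc n) f = trans (cong (_+ f (suc n)) (∑<-head n f)) (ℤ.+-assoc (f 0) _ _)

∑<-scale : ∀ n c (f : ℕ → ℤ) → ∑< n (λ i → c * f i) ≡ c * ∑< n f
∑<-scale zero    c f = sym (ℤ.*-zeroʳ c)
∑<-scale (suc n) c f = trans (cong (_+ c * f n) (∑<-scale n c f)) (sym (ℤ.*-distribˡ-+ c _ _))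

⊗-cong-≤ : ∀ {f f′ g g′} n → (∀ i → i ≤ n → f i ≡ f′ i) → (∀ i → i ≤ n → g i ≡ g′ i) →
           (f ⊗ g) n ≡ (f′ ⊗ g′) n
⊗-cong-≤ n f≡ g≡ = ∑<-cong (suc n) λ i i≤n →
  cong₂ _*_ (f≡ i (ℕ.≤-pred i≤n)) (g≡ (n ∸ i) (ℕ.m∸n≤m n i))

⊗-head : ∀ f g n → (f ⊗ g) (suc n) ≡ f 0 * g (suc n) + ((f ∘ suc) ⊗ g) n
⊗-head f g n = ∑<-head (suc n) _

⊗-last : ∀ f g n → (f ⊗ g) (suc n) ≡ (f ⊗ (g ∘ suc)) n + f (suc n) * g 0
⊗-last f g n = cong₂ _+_
  (∑<-cong (suc n) λ i i≤n → cong (λ k → f i * g k) (ℕ.+-∸-assoc 1 (ℕ.≤-pred i≤n)))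
  (cong (λ k → f (suc n) * g k) (ℕ.n∸n≡0 n))

⊗-comm : ∀ f g → f ⊗ g ≈ g ⊗ f
⊗-comm f g zero    = cong (_+_ 0ℤ) (ℤ.*-comm (f 0) (g 0))
⊗-comm f g (suc n) = begin
  (f ⊗ g) (suc n)                            ≡⟨ ⊗-last f g n ⟩
  (f ⊗ (g ∘ suc)) n + f (suc n) * g 0        ≡⟨ cong₂ _+_ (⊗-comm f (g ∘ suc) n) (ℤ.*-comm (f (suc n)) (g 0)) ⟩
  ((g ∘ suc) ⊗ f) n + g 0 * f (suc n)        ≡⟨ ℤ.+-comm (((g ∘ suc) ⊗ f) n) _ ⟩
  g 0 * f (suc n) + ((g ∘ suc) ⊗ f) n        ≡⟨ ⊗-head g f n ⟨
  (g ⊗ f) (suc n)                            ∎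
  where open ≡-Reasoning

-- Induction on the degree with shifted series: by `⊗-head`, (f ⊗ g) ∘ suc is f 0 times g ∘ suc plus
-- (f ∘ suc) ⊗ g, so no double sum has to be rearranged.
⊗-assoc : ∀ f g h → (f ⊗ g) ⊗ h ≈ f ⊗ (g ⊗ h)
⊗-assoc f g h zero = constant (f 0) (g 0) (h 0)
  where
  constant : ∀ a b c → 0ℤ + (0ℤ + a * b) * c ≡ 0ℤ + a * (0ℤ + b * c)
  constant = solve-∀
⊗-assoc f g h (suc n) = begin
  ((f ⊗ g) ⊗ h) (suc n)
    ≡⟨ ⊗-head (f ⊗ g) h n ⟩
  (0ℤ + f 0 * g 0) * h (suc n) + (((f ⊗ g) ∘ suc) ⊗ h) n
    ≡⟨ cong (_+_ ((0ℤ + f 0 * g 0) * h (suc n))) tail ⟩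
  (0ℤ + f 0 * g 0) * h (suc n) + (f 0 * ((g ∘ suc) ⊗ h) n + (((f ∘ suc) ⊗ g) ⊗ h) n)
    ≡⟨ regroup (f 0) (g 0) (h (suc n)) (((g ∘ suc) ⊗ h) n) ((((f ∘ suc) ⊗ g) ⊗ h) n) ⟩
  f 0 * (g 0 * h (suc n) + ((g ∘ suc) ⊗ h) n) + (((f ∘ suc) ⊗ g) ⊗ h) n
    ≡⟨ cong₂ (λ x y → f 0 * x + y) (sym (⊗-head g h n)) (⊗-assoc (f ∘ suc) g h n) ⟩
  f 0 * (g ⊗ h) (suc n) + ((f ∘ suc) ⊗ (g ⊗ h)) n
    ≡⟨ ⊗-head f (g ⊗ h) n ⟨
  (f ⊗ (g ⊗ h)) (suc n)
    ∎
  where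
  open ≡-Reasoning

  regroup : ∀ a b c d e → (0ℤ + a * b) * c + (a * d + e) ≡ a * (b * c + d) + e
  regroup = solve-∀

  scaled : Series
  scaled i = f 0 * g (suc i)

  tail : (((f ⊗ g) ∘ suc) ⊗ h) n ≡ f 0 * ((g ∘ suc) ⊗ h) n + (((f ∘ suc) ⊗ g) ⊗ h) n
  tail = begin
    (((f ⊗ g) ∘ suc) ⊗ h) n
      ≡⟨ ⊗-cong-≤ {(f ⊗ g) ∘ suc} {scaled ⊕ ((f ∘ suc) ⊗ g)} {h} {h} n (λ i _ → ⊗-head f g i) (λ _ _ → refl) ⟩
    ((scaled ⊕ ((f ∘ suc) ⊗ g)) ⊗ h) n
      ≡⟨ ⊗-distribʳ h scaled ((f ∘ suc) ⊗ g) n ⟩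
    (scaled ⊗ h) n + (((f ∘ suc) ⊗ g) ⊗ h) n
      ≡⟨ cong (_+ (((f ∘ suc) ⊗ g) ⊗ h) n)
           (trans (∑<-cong (suc n) (λ i _ → ℤ.*-assoc (f 0) (g (suc i)) (h (n ∸ i))))
                  (∑<-scale (suc n) (f 0) (λ i → g (suc i) * h (n ∸ i)))) ⟩
    f 0 * ((g ∘ suc) ⊗ h) n + (((f ∘ suc) ⊗ g) ⊗ h) n
      ∎

const-⊗ : ∀ c f n → (const c ⊗ f) n ≡ c * f n
const-⊗ c f zero    = ℤ.+-identityˡ _
const-⊗ c f (suc n) =
  trans (⊗-head (const c) f n)
        (trans (cong (_+_ (c * f (suc n))) (∑<-zero (suc n) (λ i _ → ℤ.*-zeroˡ (f (n ∸ i))))) (ℤ.+-identityʳ (c * f (suc n))))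

*-const : ∀ a b i → a * const b i ≡ const (a * b) i
*-const a b zero    = refl
*-const a b (suc i) = ℤ.*-zeroʳ a

infix 4 _≈[_]_

-- A record rather than a function type, so that the series and the modulus can be inferred from a
-- proof.
record _≈[_]_ (f : Series) (K : ℕ) (g : Series) : Set where
  constructor mk≈
  field
    coeff : ∀ i → i < K → f i ≡ g i

open _≈[_]_

≈⇒≈[] : ∀ {f g K} → f ≈ g → f ≈[ K ] g
≈⇒≈[] f≈g = mk≈ λ i _ → f≈g i

seriesRing : ℕ → CommutativeRing 0ℓ 0ℓ
seriesRing K = record
  { Carrier = Series
  ; _≈_ = λ f g → f ≈[ K ] g
  ; _+_ = _⊕_
  ; _*_ = _⊗_
  ; -_  = ⊖_
  ; 0#  = const 0ℤ
  ; 1#  = one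
  ; isCommutativeRing = record
    { isRing = record
      { +-isAbelianGroup = record
        { isGroup = record
          { isMonoid = record
            { isSemigroup = record
              { isMagma = record
                { isEquivalence = record
                  { refl  = mk≈ λ _ _ → refl
                  ; sym   = λ p → mk≈ λ i i<K → sym (coeff p i i<K)
                  ; trans = λ p r → mk≈ λ i i<K → trans (coeff p i i<K) (coeff r i i<K)
                  }
                ; ∙-cong = λ p r → mk≈ λ i i<K → cong₂ _+_ (coeff p i i<K) (coeff r i i<K)
                }
              ; assoc = λ f g h → ≈⇒≈[] λ i → ℤ.+-assoc (f i) (g i) (h i)
              }
            ; identity = (λ f → ≈⇒≈[] (identityˡ f))
                       , (λ f → ≈⇒≈[] λ i → trans (ℤ.+-comm (f i) (const 0ℤ i)) (identityˡ f i))
            }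
          ; inverse = (λ f → ≈⇒≈[] (inverseˡ f))
                    , (λ f → ≈⇒≈[] λ i → trans (ℤ.+-comm (f i) (- f i)) (inverseˡ f i))
          ; ⁻¹-cong = λ p → mk≈ λ i i<K → cong -_ (coeff p i i<K)
          }
        ; comm = λ f g → ≈⇒≈[] λ i → ℤ.+-comm (f i) (g i)
        }
      ; *-cong = λ {f} {f′} {g} {g′} p r → mk≈ λ i i<K →
          ⊗-cong-≤ {f} {f′} {g} {g′} i (λ j j≤i → coeff p j (ℕ.≤-<-trans j≤i i<K))
                                       (λ j j≤i → coeff r j (ℕ.≤-<-trans j≤i i<K))
      ; *-assoc = λ f g h → ≈⇒≈[] (⊗-assoc f g h)
      ; *-identity = (λ f → ≈⇒≈[] λ i → trans (⊗-comm one f i) (⊗-identityʳ f i))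
                   , (λ f → ≈⇒≈[] (⊗-identityʳ f))
      ; distrib = (λ f g h → ≈⇒≈[] (⊗-distribˡ f g h)) , (λ f g h → ≈⇒≈[] (⊗-distribʳ f g h))
      }
    ; *-comm = λ f g → ≈⇒≈[] (⊗-comm f g)
    }
  }
  where
  identityˡ : ∀ f → const 0ℤ ⊕ f ≈ f
  identityˡ f zero    = ℤ.+-identityˡ (f 0)
  identityˡ f (suc i) = ℤ.+-identityˡ (f (suc i))

  inverseˡ : ∀ f → ⊖ f ⊕ f ≈ const 0ℤ
  inverseˡ f zero    = ℤ.+-inverseˡ (f 0)
  inverseˡ f (suc i) = ℤ.+-inverseˡ (f (suc i))

module Mod (K : ℕ) where
  open CommutativeRing (seriesRing K) public
    using (setoid)
    renaming ( refl to ≈-refl; sym to ≈-sym; trans to ≈-trans; reflexive to ≈-reflexive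
             ; +-cong to ⊕-cong; *-cong to ⊗-cong; -‿cong to ⊖-cong)
  open import Relation.Binary.Reasoning.Setoid setoid public

  ⊗-congˡ : ∀ f {g h} → g ≈[ K ] h → f ⊗ g ≈[ K ] f ⊗ h
  ⊗-congˡ f = ⊗-cong (≈-refl {f})

  ⊗-congʳ : ∀ f {g h} → g ≈[ K ] h → g ⊗ f ≈[ K ] h ⊗ f
  ⊗-congʳ f p = ⊗-cong p (≈-refl {f})

  -- Constant series serve as the solver's coefficients, so that it computes with integers and
  -- compares them in ℤ.
  const-morphism : +-*-rawRing -Raw-AlmostCommutative⟶ fromCommutativeRing (seriesRing K)
  const-morphism = record
    { ⟦_⟧    = const
    ; +-homo = λ a b → ≈⇒≈[] λ { zero → refl ; (suc _) → refl }
    ; *-homo = λ a b → ≈⇒≈[] λ i → sym (trans (const-⊗ a (const b) i) (*-const a b i))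
    ; -‿homo = λ a → ≈⇒≈[] λ { zero → refl ; (suc _) → refl }
    ; 0-homo = ≈-refl
    ; 1-homo = ≈-refl
    }

  const≟ : WeaklyDecidable (Induced-equivalence const-morphism)
  const≟ a b = Maybe.map (λ a≡b → ≈-reflexive (cong const a≡b)) (dec⇒maybe (a ℤ.≟ b))

  module Solver = RingSolver +-*-rawRing (fromCommutativeRing (seriesRing K)) const-morphism const≟

  open Solver using (solve; _:=_; _:+_; _:*_; :-_; con)

  -- The way to every quotient below: clear the denominator, prove a product identity, divide back.
  -- Constant term 1 makes `recip g` an inverse of g.
  ⊘-unique : ∀ f g {h} → g 0 ≡ 1ℤ → f ⊗ g ≈[ K ] h → f ≈[ K ] h ⊘ g
  ⊘-unique f g {h} g0 fg≈h = begin
    f                   ≈⟨ solve 1 (λ f → f := f :* con 1ℤ) ≈-refl f ⟩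
    f ⊗ one             ≈⟨ ⊗-congˡ f (≈⇒≈[] (recip-inverse g g0)) ⟨
    f ⊗ (recip g ⊗ g)   ≈⟨ solve 3 (λ f g r → f :* (r :* g) := (f :* g) :* r) ≈-refl f g (recip g) ⟩
    (f ⊗ g) ⊗ recip g   ≈⟨ ⊗-congʳ (recip g) fg≈h ⟩
    h ⊗ recip g         ∎

  ⊗-cancelʳ : ∀ f g h → g 0 ≡ 1ℤ → f ⊗ g ≈[ K ] h ⊗ g → f ≈[ K ] h
  ⊗-cancelʳ f g h g0 p = ≈-trans (⊘-unique f g g0 p) (≈-sym (⊘-unique h g g0 ≈-refl))

-- Finite products and sums

∏< : ℕ → (ℕ → Series) → Series
∏< zero    f = one
∏< (suc n) f = ∏< n f ⊗ f n

∏<-constant : ∀ n {f} → (∀ i → f i 0 ≡ 1ℤ) → ∏< n f 0 ≡ 1ℤ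
∏<-constant zero    f0 = refl
∏<-constant (suc n) {f} f0 = trans (⊗-constant (∏< n f) (f n)) (cong₂ _*_ (∏<-constant n f0) (f0 n))

1-q^ 1+q^ : ℕ → Series
1-q^ e = one ⊕ (⊖ (q ^ e))
1+q^ e = one ⊕ q ^ e

1-q^-constant : ∀ e → 1-q^ (suc e) 0 ≡ 1ℤ
1-q^-constant e = cong (λ c → 1ℤ + - c) (^-Order≥ {q} refl (suc e) 0 (s≤s z≤n))

-- (q²;q²)_n, (-q²;q²)_n, (q;q²)_n and (-q;q²)_n.
D E O O⁺ : ℕ → Series
D  n = ∏< n (λ i → 1-q^ (2 ℕ.* suc i))
E  n = ∏< n (λ i → 1+q^ (2 ℕ.* suc i))
O  n = ∏< n (λ i → 1-q^ (suc (2 ℕ.* i)))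
O⁺ n = ∏< n (λ i → 1+q^ (suc (2 ℕ.* i)))

D-constant : ∀ n → D n 0 ≡ 1ℤ
D-constant n = ∏<-constant n λ i → 1-q^-constant (i ℕ.+ 1 ℕ.* suc i)

-- The sum over a + b = n. Both indices are arguments of f, so that Pascal's rules can match on
-- successors and no n ∸ a appears.
antidiagonal : (ℕ → ℕ → Series) → ℕ → Series
antidiagonal f zero    = f 0 0
antidiagonal f (suc n) = f 0 (suc n) ⊕ antidiagonal (λ a → f (suc a)) n

sqDist : ℕ → ℕ → ℕ
sqDist a n = ∣ a - n ∣ ℕ.* ∣ a - n ∣

sqDist-comm : ∀ a n → sqDist a n ≡ sqDist n a
sqDist-comm a n = cong (λ d → d ℕ.* d) (ℕ.∣-∣-comm a n)

-- This is (a - n - 1)² - (a - n)² = 2n + 1 - 2a with the negative terms moved across. It matches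
-- the exponents in the first Pascal rule.
sqDist-sucʳ : ∀ a n → sqDist a (suc n) ℕ.+ 2 ℕ.* a ≡ suc (2 ℕ.* n) ℕ.+ sqDist a n
sqDist-sucʳ zero n = square n
  where
  square : ∀ n → suc n ℕ.* suc n ℕ.+ 0 ≡ suc (2 ℕ.* n) ℕ.+ n ℕ.* n
  square = ℕ-Solver.solve-∀
sqDist-sucʳ (suc a) zero rewrite ℕ.∣-∣-identityʳ a = square a
  where
  square : ∀ a → a ℕ.* a ℕ.+ 2 ℕ.* suc a ≡ 1 ℕ.+ suc a ℕ.* suc a
  square = ℕ-Solver.solve-∀
sqDist-sucʳ (suc a) (suc n) = begin
  sqDist a (suc n) ℕ.+ 2 ℕ.* suc a        ≡⟨ shift (sqDist a (suc n)) a ⟩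
  2 ℕ.+ (sqDist a (suc n) ℕ.+ 2 ℕ.* a)    ≡⟨ cong (2 ℕ.+_) (sqDist-sucʳ a n) ⟩
  2 ℕ.+ (suc (2 ℕ.* n) ℕ.+ sqDist a n)    ≡⟨ cong (λ m → suc m ℕ.+ sqDist a n) (ℕ.*-suc 2 n) ⟨
  suc (2 ℕ.* suc n) ℕ.+ sqDist a n        ∎
  where
  open ≡-Reasoning
  shift : ∀ x a → x ℕ.+ 2 ℕ.* suc a ≡ 2 ℕ.+ (x ℕ.+ 2 ℕ.* a)
  shift = ℕ-Solver.solve-∀

-- By symmetry `sqDist-sucʳ` gives the difference 2a + 1 - 2n, and a + b = 2n turns it into 2n + 1 -
-- 2b.
sqDist-sucˡ : ∀ a b n → a ℕ.+ b ≡ n ℕ.+ n → sqDist (suc a) n ℕ.+ 2 ℕ.* b ≡ suc (2 ℕ.* n) ℕ.+ sqDist a n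
sqDist-sucˡ a b n a+b≡2n = ℕ.+-cancelʳ-≡ (2 ℕ.* n) _ _ (begin
  (sqDist (suc a) n ℕ.+ 2 ℕ.* b) ℕ.+ 2 ℕ.* n    ≡⟨ swap (sqDist (suc a) n) b n ⟩
  (sqDist (suc a) n ℕ.+ 2 ℕ.* n) ℕ.+ 2 ℕ.* b    ≡⟨ cong (λ x → (x ℕ.+ 2 ℕ.* n) ℕ.+ 2 ℕ.* b) (sqDist-comm (suc a) n) ⟩
  (sqDist n (suc a) ℕ.+ 2 ℕ.* n) ℕ.+ 2 ℕ.* b    ≡⟨ cong (ℕ._+ 2 ℕ.* b) (sqDist-sucʳ n a) ⟩
  (suc (2 ℕ.* a) ℕ.+ sqDist n a) ℕ.+ 2 ℕ.* b    ≡⟨ cong (λ x → (suc (2 ℕ.* a) ℕ.+ x) ℕ.+ 2 ℕ.* b) (sqDist-comm n a) ⟩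
  (suc (2 ℕ.* a) ℕ.+ sqDist a n) ℕ.+ 2 ℕ.* b    ≡⟨ collect a b (sqDist a n) ⟩
  suc (2 ℕ.* (a ℕ.+ b)) ℕ.+ sqDist a n          ≡⟨ cong (λ x → suc (2 ℕ.* x) ℕ.+ sqDist a n) a+b≡2n ⟩
  suc (2 ℕ.* (n ℕ.+ n)) ℕ.+ sqDist a n          ≡⟨ spread n (sqDist a n) ⟩
  (suc (2 ℕ.* n) ℕ.+ sqDist a n) ℕ.+ 2 ℕ.* n    ∎)
  where
  open ≡-Reasoning
  swap : ∀ x b n → (x ℕ.+ 2 ℕ.* b) ℕ.+ 2 ℕ.* n ≡ (x ℕ.+ 2 ℕ.* n) ℕ.+ 2 ℕ.* b
  swap = ℕ-Solver.solve-∀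
  collect : ∀ a b x → (suc (2 ℕ.* a) ℕ.+ x) ℕ.+ 2 ℕ.* b ≡ suc (2 ℕ.* (a ℕ.+ b)) ℕ.+ x
  collect = ℕ-Solver.solve-∀
  spread : ∀ n x → suc (2 ℕ.* (n ℕ.+ n)) ℕ.+ x ≡ (suc (2 ℕ.* n) ℕ.+ x) ℕ.+ 2 ℕ.* n
  spread = ℕ-Solver.solve-∀

-- The increments of 1, 3, 5, …, starting from 0.
moexStep : ℕ → ℤ
moexStep zero    = 1ℤ
moexStep (suc _) = + 2

-- The terms of Gauss's theta series, where the coefficient 2 pairs k with -k. The odd excludants
-- have the same increments, which is how this series enters.
squares : ℕ → Series
squares k = const (moexStep k) ⊗ q ^ (k ℕ.* k)

squares-Order≥ : ∀ k → Order≥ k (squares k)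
squares-Order≥ k i i<k = ⊗-Order≥ {0} {k ℕ.* k} {const (moexStep k)} {q ^ (k ℕ.* k)} (λ _ ())
  (^-Order≥ {q} refl (k ℕ.* k)) i (ℕ.<-≤-trans i<k (k≤k*k k))
  where
  k≤k*k : ∀ k → k ≤ k ℕ.* k
  k≤k*k zero    = z≤n
  k≤k*k (suc k) = ℕ.m≤m*n (suc k) (suc k)

module QSeries (K : ℕ) where
  open Mod K
  open Solver using (solve; _:=_; _:+_; _:*_; :-_; con)

  ^-cong : ∀ {f g} n → f ≈[ K ] g → f ^ n ≈[ K ] g ^ n
  ^-cong zero    p = ≈-refl
  ^-cong (suc n) p = ⊗-cong (^-cong n p) p

  ^-+ : ∀ f m n → f ^ (m ℕ.+ n) ≈[ K ] f ^ m ⊗ f ^ n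
  ^-+ f zero    n = solve 1 (λ x → x := con 1ℤ :* x) ≈-refl (f ^ n)
  ^-+ f (suc m) n = begin
    f ^ (m ℕ.+ n) ⊗ f      ≈⟨ ⊗-congʳ f (^-+ f m n) ⟩
    (f ^ m ⊗ f ^ n) ⊗ f    ≈⟨ solve 3 (λ x y z → (x :* y) :* z := (x :* z) :* y) ≈-refl (f ^ m) (f ^ n) f ⟩
    (f ^ m ⊗ f) ⊗ f ^ n    ∎

  ^-* : ∀ f m n → f ^ (m ℕ.* n) ≈[ K ] (f ^ m) ^ n
  ^-* f m zero    = ≈-reflexive (cong (f ^_) (ℕ.*-zeroʳ m))
  ^-* f m (suc n) = begin
    f ^ (m ℕ.* suc n)      ≈⟨ ≈-reflexive (cong (f ^_) (trans (ℕ.*-suc m n) (ℕ.+-comm m _))) ⟩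
    f ^ (m ℕ.* n ℕ.+ m)    ≈⟨ ^-+ f (m ℕ.* n) m ⟩
    f ^ (m ℕ.* n) ⊗ f ^ m  ≈⟨ ⊗-congʳ (f ^ m) (^-* f m n) ⟩
    (f ^ m) ^ n ⊗ f ^ m    ∎

  q^≈0 : ∀ {e} → K ≤ e → q ^ e ≈[ K ] const 0ℤ
  q^≈0 {e} K≤e = mk≈ λ i i<K → trans (^-Order≥ {q} refl e i (ℕ.<-≤-trans i<K K≤e)) (sym (zero-const i))
    where
    zero-const : ∀ i → const 0ℤ i ≡ 0ℤ
    zero-const zero    = refl
    zero-const (suc _) = refl

  ∏<-cong : ∀ n {f g} → (∀ i → i < n → f i ≈[ K ] g i) → ∏< n f ≈[ K ] ∏< n g
  ∏<-cong zero    p = ≈-refl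
  ∏<-cong (suc n) p = ⊗-cong (∏<-cong n λ i i<n → p i (ℕ.m<n⇒m<1+n i<n)) (p n (ℕ.n<1+n n))

  ∏<-⊗ : ∀ n f g → ∏< n (λ i → f i ⊗ g i) ≈[ K ] ∏< n f ⊗ ∏< n g
  ∏<-⊗ zero    f g = solve 0 (con 1ℤ := con 1ℤ :* con 1ℤ) ≈-refl
  ∏<-⊗ (suc n) f g = begin
    ∏< n (λ i → f i ⊗ g i) ⊗ (f n ⊗ g n)    ≈⟨ ⊗-congʳ (f n ⊗ g n) (∏<-⊗ n f g) ⟩
    (∏< n f ⊗ ∏< n g) ⊗ (f n ⊗ g n)         ≈⟨ solve 4 (λ a b c d → (a :* b) :* (c :* d) := (a :* c) :* (b :* d)) ≈-refl (∏< n f) (∏< n g) (f n) (g n) ⟩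
    (∏< n f ⊗ f n) ⊗ (∏< n g ⊗ g n)         ∎

  ∏<-double : ∀ n f → ∏< (2 ℕ.* n) f ≈[ K ] ∏< n (λ i → f (2 ℕ.* i) ⊗ f (suc (2 ℕ.* i)))
  ∏<-double zero    f = ≈-refl
  ∏<-double (suc n) f = begin
    ∏< (2 ℕ.* suc n) f
      ≈⟨ ≈-reflexive (cong (λ m → ∏< m f) (ℕ.*-suc 2 n)) ⟩
    (∏< (2 ℕ.* n) f ⊗ f (2 ℕ.* n)) ⊗ f (suc (2 ℕ.* n))
      ≈⟨ solve 3 (λ a b c → (a :* b) :* c := a :* (b :* c)) ≈-refl (∏< (2 ℕ.* n) f) (f (2 ℕ.* n)) (f (suc (2 ℕ.* n))) ⟩
    ∏< (2 ℕ.* n) f ⊗ (f (2 ℕ.* n) ⊗ f (suc (2 ℕ.* n)))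
      ≈⟨ ⊗-congʳ (f (2 ℕ.* n) ⊗ f (suc (2 ℕ.* n))) (∏<-double n f) ⟩
    ∏< n (λ i → f (2 ℕ.* i) ⊗ f (suc (2 ℕ.* i))) ⊗ (f (2 ℕ.* n) ⊗ f (suc (2 ℕ.* n)))
      ∎

  ∏<-stable : ∀ f → (∀ i → K ≤ i → f i ≈[ K ] one) → ∀ {n} → K ≤ n → ∏< n f ≈[ K ] ∏< K f
  ∏<-stable f f≈1 {n} K≤n = subst (λ m → ∏< m f ≈[ K ] ∏< K f) (ℕ.m∸n+n≡m K≤n) (go (n ∸ K))
    where
    go : ∀ d → ∏< (d ℕ.+ K) f ≈[ K ] ∏< K f
    go zero    = ≈-refl
    go (suc d) = begin
      ∏< (d ℕ.+ K) f ⊗ f (d ℕ.+ K)  ≈⟨ ⊗-cong (go d) (f≈1 (d ℕ.+ K) (ℕ.m≤n+m K d)) ⟩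
      ∏< K f ⊗ one                  ≈⟨ ≈⇒≈[] (⊗-identityʳ (∏< K f)) ⟩
      ∏< K f                        ∎

  1-q^≈1 : ∀ {e} → K ≤ e → 1-q^ e ≈[ K ] one
  1-q^≈1 {e} K≤e = begin
    one ⊕ (⊖ (q ^ e))       ≈⟨ ⊕-cong (≈-refl {one}) (⊖-cong (q^≈0 K≤e)) ⟩
    one ⊕ (⊖ (const 0ℤ))    ≈⟨ solve 0 (con 1ℤ :+ (:- con 0ℤ) := con 1ℤ) ≈-refl ⟩
    one                     ∎

  1+q^≈1 : ∀ {e} → K ≤ e → 1+q^ e ≈[ K ] one
  1+q^≈1 {e} K≤e = begin
    one ⊕ q ^ e         ≈⟨ ⊕-cong (≈-refl {one}) (q^≈0 K≤e) ⟩
    one ⊕ const 0ℤ      ≈⟨ solve 0 (con 1ℤ :+ con 0ℤ := con 1ℤ) ≈-refl ⟩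
    one                 ∎

  D-stable : ∀ {n} → K ≤ n → D n ≈[ K ] D K
  D-stable = ∏<-stable _ λ i K≤i → 1-q^≈1 (ℕ.≤-trans K≤i (ℕ.≤-trans (ℕ.n≤1+n i) (ℕ.m≤m+n (suc i) _)))

  O⁺-stable : ∀ {n} → K ≤ n → O⁺ n ≈[ K ] O⁺ K
  O⁺-stable = ∏<-stable _ λ i K≤i → 1+q^≈1 (ℕ.≤-trans K≤i (ℕ.≤-trans (ℕ.n≤1+n i) (ℕ.m≤m+n (suc i) _)))

  -- Gauss's square series

  antidiagonal-cong : ∀ n {f g} → (∀ a b → a ℕ.+ b ≡ n → f a b ≈[ K ] g a b) →
                      antidiagonal f n ≈[ K ] antidiagonal g n
  antidiagonal-cong zero    p = p 0 0 refl
  antidiagonal-cong (suc n) p =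
    ⊕-cong (p 0 (suc n) refl) (antidiagonal-cong n λ a b eq → p (suc a) b (cong suc eq))

  antidiagonal-⊗ : ∀ n c f → c ⊗ antidiagonal f n ≈[ K ] antidiagonal (λ a b → c ⊗ f a b) n
  antidiagonal-⊗ zero    c f = ≈-refl
  antidiagonal-⊗ (suc n) c f = begin
    c ⊗ (f 0 (suc n) ⊕ antidiagonal (λ a → f (suc a)) n)        ≈⟨ ≈⇒≈[] (⊗-distribˡ c (f 0 (suc n)) (antidiagonal (λ a → f (suc a)) n)) ⟩
    c ⊗ f 0 (suc n) ⊕ c ⊗ antidiagonal (λ a → f (suc a)) n      ≈⟨ ⊕-cong (≈-refl {c ⊗ f 0 (suc n)}) (antidiagonal-⊗ n c (λ a → f (suc a))) ⟩
    c ⊗ f 0 (suc n) ⊕ antidiagonal (λ a b → c ⊗ f (suc a) b) n  ∎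

  antidiagonal-last : ∀ n (g : ℕ → Series) →
    antidiagonal (λ a _ → g a) (suc n) ≈[ K ] antidiagonal (λ a _ → g a) n ⊕ g (suc n)
  antidiagonal-last zero    g = ≈-refl
  antidiagonal-last (suc n) g = begin
    g 0 ⊕ antidiagonal (λ a _ → g (suc a)) (suc n)
      ≈⟨ ⊕-cong (≈-refl {g 0}) (antidiagonal-last n (λ a → g (suc a))) ⟩
    g 0 ⊕ (antidiagonal (λ a _ → g (suc a)) n ⊕ g (suc (suc n)))
      ≈⟨ solve 3 (λ x y z → x :+ (y :+ z) := (x :+ y) :+ z) ≈-refl (g 0) (antidiagonal (λ a _ → g (suc a)) n) (g (suc (suc n))) ⟩
    antidiagonal (λ a _ → g a) (suc n) ⊕ g (suc (suc n))
      ∎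

  -- Here u stays in place, while v a b moves from (a, b) to (a, b + 1) on the next antidiagonal.
  antidiagonal-shift : ∀ n f u v →
    (∀ a → f a 0 ≈[ K ] u a 0) → (∀ a b → f a (suc b) ≈[ K ] u a (suc b) ⊕ v a b) →
    antidiagonal f (suc n) ≈[ K ] antidiagonal u (suc n) ⊕ antidiagonal v n
  antidiagonal-shift zero f u v f0 f+ = begin
    f 0 1 ⊕ f 1 0                ≈⟨ ⊕-cong (f+ 0 0) (f0 1) ⟩
    (u 0 1 ⊕ v 0 0) ⊕ u 1 0      ≈⟨ solve 3 (λ x y z → (x :+ y) :+ z := (x :+ z) :+ y) ≈-refl (u 0 1) (v 0 0) (u 1 0) ⟩
    (u 0 1 ⊕ u 1 0) ⊕ v 0 0      ∎
  antidiagonal-shift (suc n) f u v f0 f+ = begin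
    f 0 (suc (suc n)) ⊕ antidiagonal (λ a → f (suc a)) (suc n)
      ≈⟨ ⊕-cong (f+ 0 (suc n)) (antidiagonal-shift n (λ a → f (suc a)) (λ a → u (suc a)) (λ a → v (suc a)) (λ a → f0 (suc a)) (λ a b → f+ (suc a) b)) ⟩
    (u 0 (suc (suc n)) ⊕ v 0 (suc n)) ⊕ (U ⊕ V)
      ≈⟨ solve 4 (λ x y z w → (x :+ y) :+ (z :+ w) := (x :+ z) :+ (y :+ w)) ≈-refl (u 0 (suc (suc n))) (v 0 (suc n)) U V ⟩
    (u 0 (suc (suc n)) ⊕ U) ⊕ (v 0 (suc n) ⊕ V)
      ∎
    where
    U V : Series
    U = antidiagonal (λ a → u (suc a)) (suc n)
    V = antidiagonal (λ a → v (suc a)) n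

  -- Each point (a, b) sends u a b to (a + 1, b) and v a b to (a, b + 1); adding up what arrives on
  -- the next antidiagonal meets every value once. The first two hypotheses concern the end points,
  -- which have a single predecessor.
  antidiagonal-pascal : ∀ n f u v →
    (∀ b → f 0 (suc b) ≈[ K ] v 0 b) → (∀ a → f (suc a) 0 ≈[ K ] u a 0) →
    (∀ a b → f (suc a) (suc b) ≈[ K ] u a (suc b) ⊕ v (suc a) b) →
    antidiagonal f (suc n) ≈[ K ] antidiagonal u n ⊕ antidiagonal v n
  antidiagonal-pascal zero f u v f₀ f₁ f₂ = begin
    f 0 1 ⊕ f 1 0      ≈⟨ ⊕-cong (f₀ 0) (f₁ 0) ⟩
    v 0 0 ⊕ u 0 0      ≈⟨ solve 2 (λ x y → x :+ y := y :+ x) ≈-refl (v 0 0) (u 0 0) ⟩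
    u 0 0 ⊕ v 0 0      ∎
  antidiagonal-pascal (suc n) f u v f₀ f₁ f₂ = begin
    f 0 (suc (suc n)) ⊕ antidiagonal (λ a → f (suc a)) (suc n)
      ≈⟨ ⊕-cong (f₀ (suc n)) (antidiagonal-shift n (λ a → f (suc a)) u (λ a → v (suc a)) f₁ f₂) ⟩
    v 0 (suc n) ⊕ (U ⊕ V)
      ≈⟨ solve 3 (λ x y z → x :+ (y :+ z) := y :+ (x :+ z)) ≈-refl (v 0 (suc n)) U V ⟩
    U ⊕ (v 0 (suc n) ⊕ V)
      ∎
    where
    U V : Series
    U = antidiagonal u (suc n)
    V = antidiagonal (λ a → v (suc a)) n

  -- The Gaussian binomial coefficient of a + b over a in base q².
  gaussian : ℕ → ℕ → Series
  gaussian a b = D (a ℕ.+ b) ⊗ (recip (D a) ⊗ recip (D b))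

  -- Puts 1 / `D a` over the denominator `D (suc a)`, as needed for the common denominator in
  -- Pascal's rule.
  recip-D-suc : ∀ a → recip (D a) ≈[ K ] recip (D (suc a)) ⊗ 1-q^ (2 ℕ.* suc a)
  recip-D-suc a = ⊗-cancelʳ (recip (D a)) (D a) (recip (D (suc a)) ⊗ 1-q^ (2 ℕ.* suc a)) (D-constant a) (begin
    recip (D a) ⊗ D a                                  ≈⟨ ≈⇒≈[] (recip-inverse (D a) (D-constant a)) ⟩
    one                                                ≈⟨ ≈⇒≈[] (recip-inverse (D (suc a)) (D-constant (suc a))) ⟨
    recip (D (suc a)) ⊗ (D a ⊗ 1-q^ (2 ℕ.* suc a))     ≈⟨ solve 3 (λ r d x → r :* (d :* x) := (r :* x) :* d) ≈-refl (recip (D (suc a))) (D a) (1-q^ (2 ℕ.* suc a)) ⟩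
    (recip (D (suc a)) ⊗ 1-q^ (2 ℕ.* suc a)) ⊗ D a     ∎)

  gaussian-zeroˡ : ∀ b → gaussian 0 b ≈[ K ] one
  gaussian-zeroˡ b = ⊗-cancelʳ (gaussian 0 b) one one refl (begin
    (D b ⊗ (recip one ⊗ recip (D b))) ⊗ one    ≈⟨ solve 3 (λ d r s → (d :* (r :* s)) :* con 1ℤ := (r :* con 1ℤ) :* (s :* d)) ≈-refl (D b) (recip one) (recip (D b)) ⟩
    (recip one ⊗ one) ⊗ (recip (D b) ⊗ D b)    ≈⟨ ⊗-cong (≈⇒≈[] (recip-inverse one refl)) (≈⇒≈[] (recip-inverse (D b) (D-constant b))) ⟩
    one ⊗ one                                  ∎)

  gaussian-comm : ∀ a b → gaussian a b ≈[ K ] gaussian b a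
  gaussian-comm a b = ⊗-cong (≈-reflexive (cong D (ℕ.+-comm a b))) (≈⇒≈[] (⊗-comm (recip (D a)) (recip (D b))))

  gaussian-zeroʳ : ∀ a → gaussian a 0 ≈[ K ] one
  gaussian-zeroʳ a = ≈-trans (gaussian-comm a 0) (gaussian-zeroˡ a)

  -- Over the common denominator `D (suc a)` times `D (suc b)` this is 1 - αβ = (1 - α) + α (1 - β).
  gaussian-pascal : ∀ a b → gaussian (suc a) (suc b) ≈[ K ] gaussian a (suc b) ⊕ q ^ (2 ℕ.* suc a) ⊗ gaussian (suc a) b
  gaussian-pascal a b = begin
    (d ⊗ 1-q^ (2 ℕ.* suc (a ℕ.+ suc b))) ⊗ (r ⊗ s)
      ≈⟨ ⊗-congʳ (r ⊗ s) (⊗-congˡ d (⊕-cong (≈-refl {one}) (⊖-cong power))) ⟩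
    (d ⊗ (one ⊕ (⊖ (α ⊗ β)))) ⊗ (r ⊗ s)
      ≈⟨ solve 5 (λ d r s α β → (d :* (con 1ℤ :+ (:- (α :* β)))) :* (r :* s)
                   := d :* ((r :* (con 1ℤ :+ (:- α))) :* s) :+ α :* (d :* (r :* (s :* (con 1ℤ :+ (:- β))))))
               ≈-refl d r s α β ⟩
    d ⊗ ((r ⊗ 1-q^ (2 ℕ.* suc a)) ⊗ s) ⊕ α ⊗ (d ⊗ (r ⊗ (s ⊗ 1-q^ (2 ℕ.* suc b))))
      ≈⟨ ⊕-cong (⊗-congˡ d (⊗-congʳ s (≈-sym (recip-D-suc a))))
                (⊗-congˡ α (⊗-cong (≈-reflexive (cong D (ℕ.+-suc a b))) (⊗-congˡ r (≈-sym (recip-D-suc b))))) ⟩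
    gaussian a (suc b) ⊕ α ⊗ gaussian (suc a) b
      ∎
    where
    d r s α β : Series
    d = D (a ℕ.+ suc b)
    r = recip (D (suc a))
    s = recip (D (suc b))
    α = q ^ (2 ℕ.* suc a)
    β = q ^ (2 ℕ.* suc b)
    power : q ^ (2 ℕ.* suc (a ℕ.+ suc b)) ≈[ K ] α ⊗ β
    power = ≈-trans (≈-reflexive (cong (q ^_) (ℕ.*-distribˡ-+ 2 (suc a) (suc b)))) (^-+ q (2 ℕ.* suc a) (2 ℕ.* suc b))

  -- The first rule with a and b exchanged, which puts the power of q on the other summand.
  gaussian-pascal′ : ∀ a b → gaussian (suc a) (suc b) ≈[ K ] q ^ (2 ℕ.* suc b) ⊗ gaussian a (suc b) ⊕ gaussian (suc a) b
  gaussian-pascal′ a b = begin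
    gaussian (suc a) (suc b)                                   ≈⟨ gaussian-comm (suc a) (suc b) ⟩
    gaussian (suc b) (suc a)                                   ≈⟨ gaussian-pascal b a ⟩
    gaussian b (suc a) ⊕ q ^ (2 ℕ.* suc b) ⊗ gaussian (suc b) a       ≈⟨ ⊕-cong (gaussian-comm b (suc a)) (⊗-congˡ (q ^ (2 ℕ.* suc b)) (gaussian-comm (suc b) a)) ⟩
    gaussian (suc a) b ⊕ q ^ (2 ℕ.* suc b) ⊗ gaussian a (suc b)       ≈⟨ solve 2 (λ x y → x :+ y := y :+ x) ≈-refl (gaussian (suc a) b) (q ^ (2 ℕ.* suc b) ⊗ gaussian a (suc b)) ⟩
    q ^ (2 ℕ.* suc b) ⊗ gaussian a (suc b) ⊕ gaussian (suc a) b       ∎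

  q^-⊗ : ∀ {a b c} → a ℕ.+ b ≡ c → q ^ a ⊗ q ^ b ≈[ K ] q ^ c
  q^-⊗ {a} {b} refl = ≈-sym (^-+ q a b)

  jacobiTerm : ℕ → ℕ → ℕ → Series
  jacobiTerm n a b = q ^ sqDist a n ⊗ gaussian a b

  antidiagonal-1+ : ∀ c f n → antidiagonal f n ⊕ antidiagonal (λ a b → c ⊗ f a b) n ≈[ K ] (one ⊕ c) ⊗ antidiagonal f n
  antidiagonal-1+ c f n = begin
    F ⊕ antidiagonal (λ a b → c ⊗ f a b) n   ≈⟨ ⊕-cong (≈-refl {F}) (antidiagonal-⊗ n c f) ⟨
    F ⊕ c ⊗ F                                ≈⟨ solve 2 (λ F c → F :+ c :* F := (con 1ℤ :+ c) :* F) ≈-refl F c ⟩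
    (one ⊕ c) ⊗ F                            ∎
    where
    F : Series
    F = antidiagonal f n

  -- The centre moves from n to n + 1. A step to (a + 1, b) keeps the exponent, because the centre
  -- moves along; a step to (a, b + 1) gains exactly 2n + 1 once the power q^(2a) of the first
  -- Pascal rule is included. No relation between a + b and n is needed.
  jacobiTerm-upper : ∀ n N → antidiagonal (jacobiTerm (suc n)) (suc N) ≈[ K ] 1+q^ (suc (2 ℕ.* n)) ⊗ antidiagonal (jacobiTerm n) N
  jacobiTerm-upper n N = ≈-trans (antidiagonal-pascal N (jacobiTerm (suc n)) (jacobiTerm n) (λ a b → x ⊗ jacobiTerm n a b) first last middle)
                        (antidiagonal-1+ x (jacobiTerm n) N)
    where
    x : Series
    x = q ^ suc (2 ℕ.* n)

    first : ∀ b → jacobiTerm (suc n) 0 (suc b) ≈[ K ] x ⊗ jacobiTerm n 0 b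
    first b = begin
      q ^ sqDist 0 (suc n) ⊗ gaussian 0 (suc b)   ≈⟨ ⊗-cong (≈-sym (q^-⊗ {suc (2 ℕ.* n)} {sqDist 0 n} (trans (sym (sqDist-sucʳ 0 n)) (ℕ.+-identityʳ (sqDist 0 (suc n))))))
                                                     (≈-trans (gaussian-zeroˡ (suc b)) (≈-sym (gaussian-zeroˡ b))) ⟩
      (x ⊗ q ^ sqDist 0 n) ⊗ gaussian 0 b         ≈⟨ ≈⇒≈[] (⊗-assoc x (q ^ sqDist 0 n) (gaussian 0 b)) ⟩
      x ⊗ (q ^ sqDist 0 n ⊗ gaussian 0 b)         ∎

    last : ∀ a → jacobiTerm (suc n) (suc a) 0 ≈[ K ] jacobiTerm n a 0
    last a = ⊗-congˡ (q ^ sqDist a n) (≈-trans (gaussian-zeroʳ (suc a)) (≈-sym (gaussian-zeroʳ a)))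

    middle : ∀ a b → jacobiTerm (suc n) (suc a) (suc b) ≈[ K ] jacobiTerm n a (suc b) ⊕ x ⊗ jacobiTerm n (suc a) b
    middle a b = begin
      y ⊗ gaussian (suc a) (suc b)                       ≈⟨ ⊗-congˡ y (gaussian-pascal a b) ⟩
      y ⊗ (gaussian a (suc b) ⊕ z ⊗ gaussian (suc a) b)         ≈⟨ solve 4 (λ y z m m′ → y :* (m :+ z :* m′) := y :* m :+ (y :* z) :* m′) ≈-refl y z (gaussian a (suc b)) (gaussian (suc a) b) ⟩
      y ⊗ gaussian a (suc b) ⊕ (y ⊗ z) ⊗ gaussian (suc a) b     ≈⟨ ⊕-cong (≈-refl {y ⊗ gaussian a (suc b)}) (⊗-congʳ (gaussian (suc a) b) powers) ⟩
      y ⊗ gaussian a (suc b) ⊕ (x ⊗ w) ⊗ gaussian (suc a) b     ≈⟨ ⊕-cong (≈-refl {y ⊗ gaussian a (suc b)}) (≈⇒≈[] (⊗-assoc x w (gaussian (suc a) b))) ⟩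
      y ⊗ gaussian a (suc b) ⊕ x ⊗ (w ⊗ gaussian (suc a) b)     ∎
      where
      y z w : Series
      y = q ^ sqDist a n
      z = q ^ (2 ℕ.* suc a)
      w = q ^ sqDist (suc a) n
      powers : y ⊗ z ≈[ K ] x ⊗ w
      powers = ≈-trans (q^-⊗ {sqDist a n} (sqDist-sucʳ (suc a) n)) (^-+ q (suc (2 ℕ.* n)) (sqDist (suc a) n))

  -- The centre stays and the second Pascal rule is used. A step to (a + 1, b) now changes the
  -- exponent by 2(a + b) + 1 - 2n, which is the desired 2n + 1 precisely on the antidiagonal a + b
  -- = 2n.
  jacobiTerm-lower : ∀ n → antidiagonal (jacobiTerm n) (suc (n ℕ.+ n)) ≈[ K ] 1+q^ (suc (2 ℕ.* n)) ⊗ antidiagonal (jacobiTerm n) (n ℕ.+ n)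
  jacobiTerm-lower n = begin
    antidiagonal (jacobiTerm n) (suc (n ℕ.+ n))
      ≈⟨ antidiagonal-pascal (n ℕ.+ n) (jacobiTerm n) u (jacobiTerm n) first last middle ⟩
    antidiagonal u (n ℕ.+ n) ⊕ F
      ≈⟨ ⊕-cong (antidiagonal-cong (n ℕ.+ n) rebalance) (≈-refl {F}) ⟩
    antidiagonal (λ a b → x ⊗ jacobiTerm n a b) (n ℕ.+ n) ⊕ F
      ≈⟨ solve 2 (λ x y → x :+ y := y :+ x) ≈-refl (antidiagonal (λ a b → x ⊗ jacobiTerm n a b) (n ℕ.+ n)) F ⟩
    F ⊕ antidiagonal (λ a b → x ⊗ jacobiTerm n a b) (n ℕ.+ n)
      ≈⟨ antidiagonal-1+ x (jacobiTerm n) (n ℕ.+ n) ⟩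
    (one ⊕ x) ⊗ F
      ∎
    where
    x F : Series
    x = q ^ suc (2 ℕ.* n)
    F = antidiagonal (jacobiTerm n) (n ℕ.+ n)

    u : ℕ → ℕ → Series
    u a b = q ^ (sqDist (suc a) n ℕ.+ 2 ℕ.* b) ⊗ gaussian a b

    first : ∀ b → jacobiTerm n 0 (suc b) ≈[ K ] jacobiTerm n 0 b
    first b = ⊗-congˡ (q ^ sqDist 0 n) (≈-trans (gaussian-zeroˡ (suc b)) (≈-sym (gaussian-zeroˡ b)))

    last : ∀ a → jacobiTerm n (suc a) 0 ≈[ K ] u a 0
    last a = ⊗-cong (≈-reflexive (cong (q ^_) (sym (ℕ.+-identityʳ (sqDist (suc a) n)))))
                    (≈-trans (gaussian-zeroʳ (suc a)) (≈-sym (gaussian-zeroʳ a)))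

    middle : ∀ a b → jacobiTerm n (suc a) (suc b) ≈[ K ] u a (suc b) ⊕ jacobiTerm n (suc a) b
    middle a b = begin
      w ⊗ gaussian (suc a) (suc b)                       ≈⟨ ⊗-congˡ w (gaussian-pascal′ a b) ⟩
      w ⊗ (z ⊗ gaussian a (suc b) ⊕ gaussian (suc a) b)         ≈⟨ solve 4 (λ w z m m′ → w :* (z :* m :+ m′) := (w :* z) :* m :+ w :* m′) ≈-refl w z (gaussian a (suc b)) (gaussian (suc a) b) ⟩
      (w ⊗ z) ⊗ gaussian a (suc b) ⊕ w ⊗ gaussian (suc a) b     ≈⟨ ⊕-cong (⊗-congʳ (gaussian a (suc b)) (≈-sym (^-+ q (sqDist (suc a) n) (2 ℕ.* suc b)))) (≈-refl {w ⊗ gaussian (suc a) b}) ⟩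
      u a (suc b) ⊕ w ⊗ gaussian (suc a) b               ∎
      where
      z w : Series
      z = q ^ (2 ℕ.* suc b)
      w = q ^ sqDist (suc a) n

    rebalance : ∀ a b → a ℕ.+ b ≡ n ℕ.+ n → u a b ≈[ K ] x ⊗ jacobiTerm n a b
    rebalance a b eq = begin
      q ^ (sqDist (suc a) n ℕ.+ 2 ℕ.* b) ⊗ gaussian a b    ≈⟨ ⊗-congʳ (gaussian a b) (≈-reflexive (cong (q ^_) (sqDist-sucˡ a b n eq))) ⟩
      q ^ (suc (2 ℕ.* n) ℕ.+ sqDist a n) ⊗ gaussian a b    ≈⟨ ⊗-congʳ (gaussian a b) (^-+ q (suc (2 ℕ.* n)) (sqDist a n)) ⟩
      (x ⊗ q ^ sqDist a n) ⊗ gaussian a b                  ≈⟨ ≈⇒≈[] (⊗-assoc x (q ^ sqDist a n) (gaussian a b)) ⟩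
      x ⊗ jacobiTerm n a b                                   ∎

  -- A finite form of the Jacobi triple product at z = 1.
  finite-jacobi : ∀ n → antidiagonal (jacobiTerm n) (n ℕ.+ n) ≈[ K ] O⁺ n ⊗ O⁺ n
  finite-jacobi zero    = begin
    one ⊗ gaussian 0 0    ≈⟨ ⊗-congˡ one (gaussian-zeroˡ 0) ⟩
    one ⊗ one      ∎
  finite-jacobi (suc n) = begin
    antidiagonal (jacobiTerm (suc n)) (suc n ℕ.+ suc n)
      ≈⟨ ≈-reflexive (cong (λ m → antidiagonal (jacobiTerm (suc n)) (suc m)) (ℕ.+-suc n n)) ⟩
    antidiagonal (jacobiTerm (suc n)) (suc (suc (n ℕ.+ n)))
      ≈⟨ jacobiTerm-upper n (suc (n ℕ.+ n)) ⟩
    x ⊗ antidiagonal (jacobiTerm n) (suc (n ℕ.+ n))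
      ≈⟨ ⊗-congˡ x (jacobiTerm-lower n) ⟩
    x ⊗ (x ⊗ antidiagonal (jacobiTerm n) (n ℕ.+ n))
      ≈⟨ ⊗-congˡ x (⊗-congˡ x (finite-jacobi n)) ⟩
    x ⊗ (x ⊗ (O⁺ n ⊗ O⁺ n))
      ≈⟨ solve 2 (λ x o → x :* (x :* (o :* o)) := (o :* x) :* (o :* x)) ≈-refl x (O⁺ n) ⟩
    O⁺ (suc n) ⊗ O⁺ (suc n)
      ∎
    where
    x : Series
    x = 1+q^ (suc (2 ℕ.* n))

  partialSum-stable≈ : ∀ {t} → (∀ k → Order≥ k (t k)) → ∀ {n} → K ≤ n → partialSum t n ≈[ K ] ∑∞ t
  partialSum-stable≈ {t} ot {n} K≤n = mk≈ λ i i<K → proj₂ (∑∞-converges {t} ot i) n (ℕ.≤-trans i<K K≤n)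

  -- Passing to n + 1 adds the two ends a = 0 and a = 2n + 2, both with exponent (n + 1)²; in
  -- between, lowering a and the centre together gives the previous sum.
  antidiagonal-squares : ∀ n → antidiagonal (λ a _ → q ^ sqDist a n) (n ℕ.+ n) ≈[ K ] partialSum squares (suc n)
  antidiagonal-squares zero    = ≈⇒≈[] λ n → sym (trans (ℤ.+-identityˡ (squares 0 n)) (⊗-identityʳ one n))
  antidiagonal-squares (suc n) = begin
    antidiagonal g (suc n ℕ.+ suc n)
      ≈⟨ ≈-reflexive (cong (λ m → antidiagonal g (suc m)) (ℕ.+-suc n n)) ⟩
    y ⊕ antidiagonal (λ a _ → q ^ sqDist a n) (suc (n ℕ.+ n))
      ≈⟨ ⊕-cong (≈-refl {y}) (antidiagonal-last (n ℕ.+ n) (λ a → q ^ sqDist a n)) ⟩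
    y ⊕ (antidiagonal (λ a _ → q ^ sqDist a n) (n ℕ.+ n) ⊕ q ^ sqDist (suc (n ℕ.+ n)) n)
      ≈⟨ ⊕-cong (≈-refl {y}) (⊕-cong (antidiagonal-squares n) (≈-reflexive (cong (λ d → q ^ (d ℕ.* d)) distance))) ⟩
    y ⊕ (partialSum squares (suc n) ⊕ y)
      ≈⟨ solve 2 (λ y s → y :+ (s :+ y) := s :+ con (+ 2) :* y) ≈-refl y (partialSum squares (suc n)) ⟩
    partialSum squares (suc (suc n))
      ∎
    where
    y : Series
    y = q ^ (suc n ℕ.* suc n)
    g : ℕ → ℕ → Series
    g a _ = q ^ sqDist a (suc n)
    distance : ∣ suc (n ℕ.+ n) - n ∣ ≡ suc n
    distance = trans (ℕ.m≤n⇒∣n-m∣≡n∸m (ℕ.≤-trans (ℕ.m≤m+n n n) (ℕ.n≤1+n _))) (ℕ.m+n∸n≡m (suc n) n)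

  -- Beyond K all the products `D` agree modulo q^K, so two of them in the numerator cancel the two
  -- in the denominator.
  D⊗gaussian≈one : ∀ {a b} → K ≤ a → K ≤ b → D K ⊗ gaussian a b ≈[ K ] one
  D⊗gaussian≈one {a} {b} K≤a K≤b = begin
    D K ⊗ (D (a ℕ.+ b) ⊗ (r ⊗ s))    ≈⟨ ⊗-cong (≈-sym (D-stable K≤a)) (⊗-congʳ (r ⊗ s) (≈-trans (D-stable (ℕ.≤-trans K≤a (ℕ.m≤m+n a b))) (≈-sym (D-stable K≤b)))) ⟩
    D a ⊗ (D b ⊗ (r ⊗ s))            ≈⟨ solve 4 (λ x y r s → x :* (y :* (r :* s)) := (r :* x) :* (s :* y)) ≈-refl (D a) (D b) r s ⟩
    (r ⊗ D a) ⊗ (s ⊗ D b)            ≈⟨ ⊗-cong (≈⇒≈[] (recip-inverse (D a) (D-constant a))) (≈⇒≈[] (recip-inverse (D b) (D-constant b))) ⟩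
    one ⊗ one                        ≈⟨ ≈⇒≈[] (⊗-identityʳ one) ⟩
    one                              ∎
    where
    r s : Series
    r = recip (D a)
    s = recip (D b)

  -- Both sides vanish modulo q^K. This disposes of the Gaussian binomials that have not reached
  -- their limit.
  q^-absorbs : ∀ {e} f g → K ≤ e → f ⊗ (q ^ e ⊗ g) ≈[ K ] q ^ e
  q^-absorbs {e} f g K≤e = begin
    f ⊗ (q ^ e ⊗ g)         ≈⟨ ⊗-congˡ f (⊗-congʳ g (q^≈0 K≤e)) ⟩
    f ⊗ (const 0ℤ ⊗ g)      ≈⟨ solve 2 (λ f g → f :* (con 0ℤ :* g) := con 0ℤ) ≈-refl f g ⟩
    const 0ℤ                ≈⟨ q^≈0 K≤e ⟨
    q ^ e                   ∎

  gauss : D K ⊗ (O⁺ K ⊗ O⁺ K) ≈[ K ] ∑∞ squares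
  gauss = begin
    D K ⊗ (O⁺ K ⊗ O⁺ K)
      ≈⟨ ⊗-congˡ (D K) (⊗-cong (O⁺-stable K≤n) (O⁺-stable K≤n)) ⟨
    D K ⊗ (O⁺ n ⊗ O⁺ n)
      ≈⟨ ⊗-congˡ (D K) (finite-jacobi n) ⟨
    D K ⊗ antidiagonal (jacobiTerm n) (n ℕ.+ n)
      ≈⟨ antidiagonal-⊗ (n ℕ.+ n) (D K) (jacobiTerm n) ⟩
    antidiagonal (λ a b → D K ⊗ jacobiTerm n a b) (n ℕ.+ n)
      ≈⟨ antidiagonal-cong (n ℕ.+ n) term ⟩
    antidiagonal (λ a _ → q ^ sqDist a n) (n ℕ.+ n)
      ≈⟨ antidiagonal-squares n ⟩
    partialSum squares (suc n)
      ≈⟨ partialSum-stable≈ {squares} squares-Order≥ (ℕ.≤-trans K≤n (ℕ.n≤1+n n)) ⟩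
    ∑∞ squares
      ∎
    where
    -- With n = 2K, an index a < K or b < K puts a at distance at least K from n, so that the power
    -- of q in that term vanishes.
    n : ℕ
    n = K ℕ.+ K

    K≤n : K ≤ n
    K≤n = ℕ.m≤m+n K K

    K≤n∸ : ∀ {a} → a ≤ K → K ≤ n ∸ a
    K≤n∸ {a} a≤K = subst (_≤ n ∸ a) (ℕ.m+n∸n≡m K K) (ℕ.∸-monoʳ-≤ n a≤K)

    square-bound : ∀ {d} → K ≤ d → K ≤ d ℕ.* d
    square-bound {zero}  K≤d = K≤d
    square-bound {suc d} K≤d = ℕ.≤-trans K≤d (ℕ.m≤m*n (suc d) (suc d))

    term : ∀ a b → a ℕ.+ b ≡ n ℕ.+ n → D K ⊗ jacobiTerm n a b ≈[ K ] q ^ sqDist a n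
    term a b a+b≡2n with K ℕ.≤? a | K ℕ.≤? b
    ... | yes K≤a | yes K≤b = begin
      D K ⊗ (q ^ sqDist a n ⊗ gaussian a b)    ≈⟨ solve 3 (λ d x m → d :* (x :* m) := x :* (d :* m)) ≈-refl (D K) (q ^ sqDist a n) (gaussian a b) ⟩
      q ^ sqDist a n ⊗ (D K ⊗ gaussian a b)    ≈⟨ ⊗-congˡ (q ^ sqDist a n) (D⊗gaussian≈one K≤a K≤b) ⟩
      q ^ sqDist a n ⊗ one              ≈⟨ ≈⇒≈[] (⊗-identityʳ (q ^ sqDist a n)) ⟩
      q ^ sqDist a n                    ∎
    ... | no K≰a | _ = q^-absorbs (D K) (gaussian a b) (square-bound (subst (K ≤_) (sym (ℕ.m≤n⇒∣m-n∣≡n∸m (ℕ.≤-trans a≤K K≤n))) (K≤n∸ a≤K)))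
      where
      a≤K : a ≤ K
      a≤K = ℕ.<⇒≤ (ℕ.≰⇒> K≰a)
    ... | yes _ | no K≰b = q^-absorbs (D K) (gaussian a b) (square-bound (subst (K ≤_) (sym distance) (K≤n∸ b≤K)))
      where
      b≤K : b ≤ K
      b≤K = ℕ.<⇒≤ (ℕ.≰⇒> K≰b)
      b≤n : b ≤ n
      b≤n = ℕ.≤-trans b≤K K≤n
      a≡ : a ≡ n ℕ.+ (n ∸ b)
      a≡ = trans (sym (ℕ.m+n∸n≡m a b)) (trans (cong (_∸ b) a+b≡2n) (ℕ.+-∸-assoc n b≤n))
      distance : ∣ a - n ∣ ≡ n ∸ b
      distance = trans (cong ∣_- n ∣ a≡) (trans (ℕ.m≤n⇒∣n-m∣≡n∸m (ℕ.m≤m+n n (n ∸ b))) (ℕ.m+n∸m≡n n (n ∸ b)))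

-- Weighted enumeration of partitions by their largest part

q⊗-suc : ∀ f n → (q ⊗ f) (suc n) ≡ f n
q⊗-suc f n = begin
  (q ⊗ f) (suc n)                         ≡⟨ ⊗-head q f n ⟩
  0ℤ * f (suc n) + ((q ∘ suc) ⊗ f) n      ≡⟨ ℤ.+-identityˡ _ ⟩
  ((q ∘ suc) ⊗ f) n                       ≡⟨ ⊗-cong-≤ {q ∘ suc} {one} {f} {f} n (λ { zero _ → refl ; (suc _) _ → refl }) (λ _ _ → refl) ⟩
  (one ⊗ f) n                             ≡⟨ const-⊗ 1ℤ f n ⟩
  1ℤ * f n                                ≡⟨ ℤ.*-identityˡ (f n) ⟩
  f n                                     ∎
  where open ≡-Reasoning

q^⊗-shift : ∀ p f n → (q ^ p ⊗ f) (p ℕ.+ n) ≡ f n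
q^⊗-shift zero    f n = trans (const-⊗ 1ℤ f n) (ℤ.*-identityˡ (f n))
q^⊗-shift (suc p) f n = begin
  ((q ^ p ⊗ q) ⊗ f) (suc p ℕ.+ n)     ≡⟨ ⊗-assoc (q ^ p) q f (suc p ℕ.+ n) ⟩
  (q ^ p ⊗ (q ⊗ f)) (suc p ℕ.+ n)     ≡⟨ cong (q ^ p ⊗ (q ⊗ f)) (ℕ.+-suc p n) ⟨
  (q ^ p ⊗ (q ⊗ f)) (p ℕ.+ suc n)     ≡⟨ q^⊗-shift p (q ⊗ f) (suc n) ⟩
  (q ⊗ f) (suc n)                     ≡⟨ q⊗-suc f n ⟩
  f n                                 ∎
  where open ≡-Reasoning

q^⊗-below : ∀ p f {n} → n < p → (q ^ p ⊗ f) n ≡ 0ℤ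
q^⊗-below p f {n} n<p = ⊗-Order≥ {p} {0} {q ^ p} {f} (^-Order≥ {q} refl p) (λ _ ()) n
  (subst (n <_) (sym (ℕ.+-identityʳ p)) n<p)

-- Sums over lists, and the recursion of the enumeration

∑ : {A : Set} → List A → (A → ℤ) → ℤ
∑ []       f = 0ℤ
∑ (x ∷ xs) f = f x + ∑ xs f

∑-cong : {A : Set} (xs : List A) {f g : A → ℤ} → (∀ {x} → x ∈ xs → f x ≡ g x) → ∑ xs f ≡ ∑ xs g
∑-cong []       eq = refl
∑-cong (x ∷ xs) eq = cong₂ _+_ (eq (here refl)) (∑-cong xs (eq ∘ there))

∑-++ : {A : Set} (xs ys : List A) (f : A → ℤ) → ∑ (xs ++ ys) f ≡ ∑ xs f + ∑ ys f
∑-++ []       ys f = sym (ℤ.+-identityˡ _)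
∑-++ (x ∷ xs) ys f = trans (cong (_+_ (f x)) (∑-++ xs ys f)) (sym (ℤ.+-assoc (f x) _ _))

∑-map : {A B : Set} (h : A → B) (xs : List A) (f : B → ℤ) → ∑ (map h xs) f ≡ ∑ xs (f ∘ h)
∑-map h []       f = refl
∑-map h (x ∷ xs) f = cong (_+_ (f (h x))) (∑-map h xs f)

∑-scale : {A : Set} (c : ℤ) (xs : List A) (f : A → ℤ) → ∑ xs (λ x → c * f x) ≡ c * ∑ xs f
∑-scale c []       f = sym (ℤ.*-zeroʳ c)
∑-scale c (x ∷ xs) f = trans (cong (_+_ (c * f x)) (∑-scale c xs f)) (sym (ℤ.*-distribˡ-+ c (f x) _))

∑-∑< : {A : Set} (xs : List A) (N : ℕ) (f : ℕ → A → ℤ) →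
       ∑ xs (λ x → ∑< N (λ k → f k x)) ≡ ∑< N (λ k → ∑ xs (f k))
∑-∑< []       N f = sym (∑<-zero N (λ _ _ → refl))
∑-∑< (x ∷ xs) N f = trans (cong (_+_ (∑< N (λ k → f k x))) (∑-∑< xs N f))
  (sym (∑<-distrib-+ N (λ k → f k x) (λ k → ∑ xs (f k))))

-- A partition of n has at most n parts, so two bounds of at least n give the very same list.
partitionsWithin-fuel : ∀ l l′ m n → n ≤ l → n ≤ l′ → partitionsWithin l m n ≡ partitionsWithin l′ m n
partitionsWithin-fuel l       l′       m zero    _         _          = refl
partitionsWithin-fuel (suc l) (suc l′) m (suc n) (s≤s n≤l) (s≤s n≤l′) =
  concatMap-cong (λ p → cong (map (suc p ∷_))
    (partitionsWithin-fuel l l′ (suc p) (n ∸ p) (ℕ.≤-trans (ℕ.m∸n≤m n p) n≤l) (ℕ.≤-trans (ℕ.m∸n≤m n p) n≤l′)))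
    (upTo (m ⊓ suc n))

partitionsWithin-≥ : ∀ l {m m′} n → n ≤ m → n ≤ m′ → partitionsWithin l m n ≡ partitionsWithin l m′ n
partitionsWithin-≥ l       zero    _ _ = refl
partitionsWithin-≥ zero    (suc n) _ _ = refl
partitionsWithin-≥ (suc l) (suc n) n<m n<m′ =
  cong (λ k → concatMap (λ p → map (suc p ∷_) (partitionsWithin l (suc p) (n ∸ p))) (upTo k))
    (trans (ℕ.m≥n⇒m⊓n≡n n<m) (sym (ℕ.m≥n⇒m⊓n≡n n<m′)))

-- Splits off the partitions whose largest part is m + 1. They come last, since the largest part is
-- enumerated in increasing order; once that part is removed, m + 1 may still occur in the rest.
partitionsWithin-suc : ∀ l m r → partitionsWithin (suc l) (suc m) (suc m ℕ.+ r) ≡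
  partitionsWithin (suc l) m (suc m ℕ.+ r) ++ map (suc m ∷_) (partitionsWithin l (suc m) r)
partitionsWithin-suc l m r = begin
  concatMap F (upTo (suc m ⊓ suc (m ℕ.+ r)))
    ≡⟨ cong (concatMap F ∘ upTo) (ℕ.m≤n⇒m⊓n≡m (ℕ.m≤m+n (suc m) r)) ⟩
  concatMap F (upTo (suc m))
    ≡⟨ cong (concatMap F) (upTo-∷ʳ m) ⟨
  concatMap F (upTo m ++ m ∷ [])
    ≡⟨ concatMap-++ F (upTo m) (m ∷ []) ⟩
  concatMap F (upTo m) ++ (F m ++ [])
    ≡⟨ cong₂ _++_ (cong (concatMap F ∘ upTo) (sym (ℕ.m≤n⇒m⊓n≡m (ℕ.≤-trans (ℕ.n≤1+n m) (ℕ.m≤m+n (suc m) r)))))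
                  (trans (++-identityʳ (F m)) (cong (λ k → map (suc m ∷_) (partitionsWithin l (suc m) k)) (ℕ.m+n∸m≡n m r))) ⟩
  concatMap F (upTo (m ⊓ suc (m ℕ.+ r))) ++ map (suc m ∷_) (partitionsWithin l (suc m) r)
    ∎
  where
  open ≡-Reasoning
  F : ℕ → List (List ℕ)
  F p = map (suc p ∷_) (partitionsWithin l (suc p) (m ℕ.+ r ∸ p))

-- One factor for each part size from 1 to m, depending only on its multiplicity: this is what lets
-- a sum over partitions become a product of series.
weight : (ℕ → ℕ → ℤ) → ℕ → List ℕ → ℤ
weight w zero    λs = 1ℤ
weight w (suc m) λs = weight w m λs * w (suc m) (multiplicity (suc m) λs)

weightedCount : (ℕ → ℕ → ℤ) → ℕ → Series
weightedCount w m n = ∑ (partitionsWithin n m n) (weight w m)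

multiplicity-∷≡ : ∀ p λs → multiplicity p (p ∷ λs) ≡ suc (multiplicity p λs)
multiplicity-∷≡ p λs = cong length (filter-accept (p ℕ.≟_) refl)

multiplicity-∷≢ : ∀ {p r} → p ≢ r → ∀ λs → multiplicity p (r ∷ λs) ≡ multiplicity p λs
multiplicity-∷≢ {p} p≢r λs = cong length (filter-reject (p ℕ.≟_) p≢r)

multiplicity-replicate≡ : ∀ p i λs → multiplicity p (replicate i p ++ λs) ≡ i ℕ.+ multiplicity p λs
multiplicity-replicate≡ p zero    λs = refl
multiplicity-replicate≡ p (suc i) λs =
  trans (multiplicity-∷≡ p (replicate i p ++ λs)) (cong suc (multiplicity-replicate≡ p i λs))

multiplicity-replicate≢ : ∀ {p r} → p ≢ r → ∀ i λs → multiplicity p (replicate i r ++ λs) ≡ multiplicity p λs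
multiplicity-replicate≢ p≢r zero    λs = refl
multiplicity-replicate≢ {r = r} p≢r (suc i) λs =
  trans (multiplicity-∷≢ p≢r (replicate i r ++ λs)) (multiplicity-replicate≢ p≢r i λs)

multiplicity-> : ∀ {p m} → m < p → ∀ {λs} → All (_≤ m) λs → multiplicity p λs ≡ 0
multiplicity-> m<p []                = refl
multiplicity-> m<p (_∷_ {_} {λs} r≤m all) =
  trans (multiplicity-∷≢ (λ { refl → ℕ.<⇒≱ m<p r≤m }) λs) (multiplicity-> m<p all)

weight-replicate : ∀ w {m r} → m < r → ∀ i λs → weight w m (replicate i r ++ λs) ≡ weight w m λs
weight-replicate w {zero}  _   i λs = refl
weight-replicate w {suc m} m<r i λs =
  cong₂ _*_ (weight-replicate w (ℕ.<-trans (ℕ.n<1+n m) m<r) i λs)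
            (cong (w (suc m)) (multiplicity-replicate≢ (ℕ.<⇒≢ m<r) i λs))

Linked⇒All≤ : ∀ {m λs} → Linked _≥_ (m ∷ λs) → All (_≤ m) λs
Linked⇒All≤ [-]           = []
Linked⇒All≤ (m≥p ∷ chain) = m≥p ∷ All.map (λ r≤p → ℕ.≤-trans r≤p m≥p) (Linked⇒All≤ chain)

-- V j plays the role of the series ∑ᵢ w (m + 1) (j + i) q^(i (m + 1)): it accounts for the copies of the
-- part m + 1 beyond the first j.
weightedCount-suc : ∀ w m (V : ℕ → Series) →
  (∀ j → V j ≈ const (w (suc m) j) ⊕ q ^ suc m ⊗ V (suc j)) →
  weightedCount w (suc m) ≈ weightedCount w m ⊗ V 0
weightedCount-suc w m V V-rec n = main n 0
  where
  open ≡-Reasoning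
  p : ℕ
  p = suc m

  -- The weight of λs with j deleted copies of p put back. As λs may still contain p, the factor for
  -- p is settled only when no copy is left.
  g : ℕ → List ℕ → ℤ
  g j λs = weight w p (replicate j p ++ λs)

  a : Series
  a = weightedCount w m

  without : ∀ n j → ∑ (partitionsWithin n m n) (g j) ≡ w p j * a n
  without n j = trans (∑-cong (partitionsWithin n m n) term) (∑-scale (w p j) (partitionsWithin n m n) (weight w m))
    where
    term : ∀ {λs} → λs ∈ partitionsWithin n m n → g j λs ≡ w p j * weight w m λs
    term {λs} λs∈ = trans
      (cong₂ _*_ (weight-replicate w (ℕ.n<1+n m) j λs)
        (cong (w p) (trans (multiplicity-replicate≡ p j λs)
          (trans (cong (j ℕ.+_) (multiplicity-> (ℕ.n<1+n m) (Linked⇒All≤ (proj₁ (∈-partitionsWithin⁻ n m n λs∈)))))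
                 (ℕ.+-identityʳ j)))))
      (ℤ.*-comm (weight w m λs) (w p j))

  replicate-shift : ∀ j λs → replicate j p ++ p ∷ λs ≡ p ∷ (replicate j p ++ λs)
  replicate-shift zero    λs = refl
  replicate-shift (suc j) λs = cong (p ∷_) (replicate-shift j λs)

  expand : ∀ n j → (a ⊗ V j) n ≡ w p j * a n + (q ^ p ⊗ (a ⊗ V (suc j))) n
  expand n j = begin
    (a ⊗ V j) n
      ≡⟨ ⊗-cong-≤ {a} {a} {V j} {const (w p j) ⊕ q ^ p ⊗ V (suc j)} n (λ _ _ → refl) (λ i _ → V-rec j i) ⟩
    (a ⊗ (const (w p j) ⊕ q ^ p ⊗ V (suc j))) n
      ≡⟨ coeff (solve 4 (λ a c x v → a :* (c :+ x :* v) := c :* a :+ x :* (a :* v)) ≈-refl a (const (w p j)) (q ^ p) (V (suc j))) n (ℕ.n<1+n n) ⟩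
    (const (w p j) ⊗ a) n + (q ^ p ⊗ (a ⊗ V (suc j))) n
      ≡⟨ cong (_+ (q ^ p ⊗ (a ⊗ V (suc j))) n) (const-⊗ (w p j) a n) ⟩
    w p j * a n + (q ^ p ⊗ (a ⊗ V (suc j))) n
      ∎
    where
    open Mod (suc n) using (≈-refl; module Solver)
    open Solver using (solve; _:=_; _:+_; _:*_)

  step : ∀ n → (∀ {r} → r < n → ∀ j → ∑ (partitionsWithin r p r) (g j) ≡ (a ⊗ V j) r) →
         ∀ j → ∑ (partitionsWithin n p n) (g j) ≡ (a ⊗ V j) n
  step n ih j with p ℕ.≤? n
  ... | no p≰n = begin
    ∑ (partitionsWithin n p n) (g j)             ≡⟨ cong (λ xs → ∑ xs (g j)) (partitionsWithin-≥ n n (ℕ.≤-trans n≤m (ℕ.n≤1+n m)) n≤m) ⟩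
    ∑ (partitionsWithin n m n) (g j)             ≡⟨ without n j ⟩
    w p j * a n                                  ≡⟨ ℤ.+-identityʳ (w p j * a n) ⟨
    w p j * a n + 0ℤ                             ≡⟨ cong (_+_ (w p j * a n)) (q^⊗-below p (a ⊗ V (suc j)) (s≤s n≤m)) ⟨
    w p j * a n + (q ^ p ⊗ (a ⊗ V (suc j))) n    ≡⟨ expand n j ⟨
    (a ⊗ V j) n                                  ∎
    where
    n≤m : n ≤ m
    n≤m = ℕ.≤-pred (ℕ.≰⇒> p≰n)
  -- A partition of p + r with parts up to p either avoids p, or loses one copy of it and becomes
  -- such a partition of r, where the induction hypothesis is applied to j + 1.
  ... | yes p≤n with n ∸ p | sym (ℕ.m+[n∸m]≡n p≤n)
  ... | r | refl = begin
    ∑ (partitionsWithin (p ℕ.+ r) p (p ℕ.+ r)) (g j)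
      ≡⟨ cong (λ xs → ∑ xs (g j)) (partitionsWithin-suc (m ℕ.+ r) m r) ⟩
    ∑ (partitionsWithin (p ℕ.+ r) m (p ℕ.+ r) ++ map (p ∷_) (partitionsWithin (m ℕ.+ r) p r)) (g j)
      ≡⟨ ∑-++ (partitionsWithin (p ℕ.+ r) m (p ℕ.+ r)) _ (g j) ⟩
    ∑ (partitionsWithin (p ℕ.+ r) m (p ℕ.+ r)) (g j) + ∑ (map (p ∷_) (partitionsWithin (m ℕ.+ r) p r)) (g j)
      ≡⟨ cong₂ _+_ (without (p ℕ.+ r) j) (∑-map (p ∷_) (partitionsWithin (m ℕ.+ r) p r) (g j)) ⟩
    w p j * a (p ℕ.+ r) + ∑ (partitionsWithin (m ℕ.+ r) p r) (g j ∘ (p ∷_))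
      ≡⟨ cong (_+_ (w p j * a (p ℕ.+ r))) (∑-cong (partitionsWithin (m ℕ.+ r) p r) (λ {λs} _ → cong (weight w p) (replicate-shift j λs))) ⟩
    w p j * a (p ℕ.+ r) + ∑ (partitionsWithin (m ℕ.+ r) p r) (g (suc j))
      ≡⟨ cong (λ xs → w p j * a (p ℕ.+ r) + ∑ xs (g (suc j))) (partitionsWithin-fuel (m ℕ.+ r) r p r (ℕ.m≤n+m r m) ℕ.≤-refl) ⟩
    w p j * a (p ℕ.+ r) + ∑ (partitionsWithin r p r) (g (suc j))
      ≡⟨ cong (_+_ (w p j * a (p ℕ.+ r))) (ih (s≤s (ℕ.m≤n+m r m)) (suc j)) ⟩
    w p j * a (p ℕ.+ r) + (a ⊗ V (suc j)) r
      ≡⟨ cong (_+_ (w p j * a (p ℕ.+ r))) (q^⊗-shift p (a ⊗ V (suc j)) r) ⟨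
    w p j * a (p ℕ.+ r) + (q ^ p ⊗ (a ⊗ V (suc j))) (p ℕ.+ r)
      ≡⟨ expand (p ℕ.+ r) j ⟨
    (a ⊗ V j) (p ℕ.+ r)
      ∎

  main : ∀ n j → ∑ (partitionsWithin n p n) (g j) ≡ (a ⊗ V j) n
  main = <-rec (λ n → ∀ j → ∑ (partitionsWithin n p n) (g j) ≡ (a ⊗ V j) n) step

weightedCount-∏ : ∀ K w (V : ℕ → ℕ → Series) →
  (∀ m j → V m j ≈ const (w (suc m) j) ⊕ q ^ suc m ⊗ V m (suc j)) →
  ∀ m → weightedCount w m ≈[ K ] ∏< m (λ p → V p 0)
weightedCount-∏ K w V V-rec zero    = ≈⇒≈[] λ { zero → refl ; (suc _) → refl }
weightedCount-∏ K w V V-rec (suc m) =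
  ≈-trans (≈⇒≈[] (weightedCount-suc w m (V m) (V-rec m))) (⊗-congʳ (V m 0) (weightedCount-∏ K w V V-rec m))
  where open Mod K

-- Minimal excludants as weighted counts

-- allowed e r j indicates whether an even (e) or odd part that is required (r) or optional
-- may have multiplicity j.
allowed : Bool → Bool → ℕ → ℤ
allowed false false _             = 1ℤ
allowed false true  zero          = 0ℤ
allowed false true  (suc _)       = 1ℤ
allowed true  false zero          = 1ℤ
allowed true  true  zero          = 0ℤ
allowed true  _     (suc zero)    = 1ℤ
allowed true  _     (suc (suc _)) = 0ℤ

allowed-yes : {A B : Set} (A? : Dec A) (B? : Dec B) → ∀ {j} → (A → j ≤ 1) → (B → 0 < j) →
              allowed (does A?) (does B?) j ≡ 1ℤ
allowed-yes (no _)  (no _)  _  _  = refl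
allowed-yes (no _)  (yes b) {zero}        _  lo = contradiction (lo b) λ ()
allowed-yes (no _)  (yes _) {suc _}       _  _  = refl
allowed-yes (yes _) (no _)  {zero}        _  _  = refl
allowed-yes (yes _) (yes b) {zero}        _  lo = contradiction (lo b) λ ()
allowed-yes (yes _) (no _)  {suc zero}    _  _  = refl
allowed-yes (yes _) (yes _) {suc zero}    _  _  = refl
allowed-yes (yes a) _       {suc (suc _)} hi _  = contradiction (hi a) λ { (s≤s ()) }

allowed-missing : {A B : Set} (A? : Dec A) (B? : Dec B) → B → allowed (does A?) (does B?) 0 ≡ 0ℤ
allowed-missing _       (no ¬b) b = contradiction b ¬b
allowed-missing (no _)  (yes _) _ = refl
allowed-missing (yes _) (yes _) _ = refl

allowed-repeated : {A : Set} (A? : Dec A) (r : Bool) → A → ∀ {j} → ¬ j ≤ 1 → allowed (does A?) r j ≡ 0ℤ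
allowed-repeated (no ¬a) _ a _ = contradiction a ¬a
allowed-repeated (yes _) _ _ {zero}        j≰1 = contradiction z≤n j≰1
allowed-repeated (yes _) _ _ {suc zero}    j≰1 = contradiction (s≤s z≤n) j≰1
allowed-repeated (yes _) false _ {suc (suc _)} _ = refl
allowed-repeated (yes _) true  _ {suc (suc _)} _ = refl

weight-one : ∀ w m {λs} → (∀ p → 0 < p → w p (multiplicity p λs) ≡ 1ℤ) → weight w m λs ≡ 1ℤ
weight-one w zero    _  = refl
weight-one w (suc m) w1 = cong₂ _*_ (weight-one w m w1) (w1 (suc m) (s≤s z≤n))

weight-zero : ∀ w m {λs p} → 0 < p → p ≤ m → w p (multiplicity p λs) ≡ 0ℤ → weight w m λs ≡ 0ℤ
weight-zero w zero    (s≤s _) ()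
weight-zero w (suc m) {λs} {p} 0<p p≤1+m w0 with p ℕ.≟ suc m
... | yes refl = trans (cong (weight w m λs *_) w0) (ℤ.*-zeroʳ (weight w m λs))
... | no p≢1+m = cong (_* w (suc m) (multiplicity (suc m) λs))
                      (weight-zero w m 0<p (ℕ.≤-pred (ℕ.≤∧≢⇒< p≤1+m p≢1+m)) w0)

∈⇒0<multiplicity : ∀ {p λs} → p ∈ λs → 0 < multiplicity p λs
∈⇒0<multiplicity {p} {.p ∷ λs} (here refl) = subst (0 <_) (sym (multiplicity-∷≡ p λs)) (s≤s z≤n)
∈⇒0<multiplicity {p} {r ∷ λs}  (there p∈)  with p ℕ.≟ r
... | yes refl = subst (0 <_) (sym (multiplicity-∷≡ p λs)) (s≤s z≤n)
... | no p≢r   = subst (0 <_) (sym (multiplicity-∷≢ p≢r λs)) (∈⇒0<multiplicity p∈)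

∉⇒multiplicity≡0 : ∀ {p λs} → p ∉ λs → multiplicity p λs ≡ 0
∉⇒multiplicity≡0 {p} {[]}     _  = refl
∉⇒multiplicity≡0 {p} {r ∷ λs} p∉ =
  trans (multiplicity-∷≢ (p∉ ∘ here) λs) (∉⇒multiplicity≡0 (p∉ ∘ there))

-- In the following the Boolean says whether even (true) or odd (false) excludants are meant.

HasParity : Bool → Pred ℕ 0ℓ
HasParity true  p = 2 ∣ p
HasParity false p = ¬ (2 ∣ p)

hasParity? : ∀ e → Decidable (HasParity e)
hasParity? true  p = 2 ∣? p
hasParity? false p = ¬? (2 ∣? p)

Missing : Bool → List ℕ → Pred ℕ 0ℓ
Missing e λs d = 0 < d × HasParity e d × d ∉ λs

excludant : Bool → ℕ → ℕ
excludant true  k = 2 ℕ.* suc k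
excludant false k = suc (2 ℕ.* k)

-- The increments of `excludant e` counted from 0, hence starting with 2 in the even and with 1 in
-- the odd case.
increment : Bool → ℕ → ℤ
increment true  _ = + 2
increment false k = moexStep k

-- The parts that must occur for the minimal excludant to be at least `excludant e k`.
Required : Bool → ℕ → Pred ℕ 0ℓ
Required e k p = p < excludant e k × HasParity e p

required? : ∀ e k → Decidable (Required e k)
required? e k p = (p ℕ.<? excludant e k) ×-dec hasParity? e p

edWeight : Bool → ℕ → ℕ → ℕ → ℤ
edWeight e k p = allowed (does (2 ∣? p)) (does (required? e k p))

2∤1+2n : ∀ n → ¬ (2 ∣ suc (2 ℕ.* n))
2∤1+2n n 2∣ = contradiction (∣1⇒≡1 (∣m+n∣m⇒∣n (subst (2 ∣_) (ℕ.+-comm 1 (2 ℕ.* n)) 2∣) (m∣m*n n))) λ ()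

excludant-parity : ∀ e k → HasParity e (excludant e k)
excludant-parity true  k = m∣m*n (suc k)
excludant-parity false k = 2∤1+2n k

excludant-positive : ∀ e k → 0 < excludant e k
excludant-positive true  k = s≤s z≤n
excludant-positive false k = s≤s z≤n

excludant-mono : ∀ e {j k} → j ≤ k → excludant e j ≤ excludant e k
excludant-mono true  j≤k = ℕ.*-monoʳ-≤ 2 (s≤s j≤k)
excludant-mono false j≤k = s≤s (ℕ.*-monoʳ-≤ 2 j≤k)

excludant-mono-< : ∀ e {j k} → j < k → excludant e j < excludant e k
excludant-mono-< true  j<k = ℕ.*-monoʳ-< 2 (s≤s j<k)
excludant-mono-< false j<k = s≤s (ℕ.*-monoʳ-< 2 j<k)

excludant> : ∀ e k → k < excludant e k
excludant> true  k = ℕ.m≤m+n (suc k) _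
excludant> false k = s≤s (ℕ.m≤m+n k _)

excludant≤ : ∀ e {k N} → k < N → excludant e k ≤ 2 ℕ.* N
excludant≤ true  k<N = ℕ.*-monoʳ-≤ 2 k<N
excludant≤ false {k} {N} k<N = ℕ.≤-trans (ℕ.n≤1+n _) (subst (_≤ 2 ℕ.* N) (ℕ.*-suc 2 k) (ℕ.*-monoʳ-≤ 2 k<N))

odd-decomposition : ∀ d → ¬ (2 ∣ d) → ∃ λ r → d ≡ suc (2 ℕ.* r)
odd-decomposition zero          odd = contradiction (divides 0 refl) odd
odd-decomposition (suc zero)    odd = 0 , refl
odd-decomposition (suc (suc d)) odd
  with r , d≡ ← odd-decomposition d (λ 2∣d → odd (∣m∣n⇒∣m+n (divides 1 refl) 2∣d))
  = suc r , trans (cong (suc ∘ suc) d≡) (cong suc (sym (ℕ.*-suc 2 r)))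

excludant-decomposition : ∀ e d → 0 < d → HasParity e d → ∃ λ r → d ≡ excludant e r
excludant-decomposition true  d 0<d (divides zero    refl) = contradiction 0<d λ ()
excludant-decomposition true  d 0<d (divides (suc r) refl) = r , ℕ.*-comm (suc r) 2
excludant-decomposition false d 0<d odd                    = odd-decomposition d odd

∑<-increment : ∀ e r → ∑< (suc r) (increment e) ≡ + excludant e r
∑<-increment true  zero    = refl
∑<-increment false zero    = refl
∑<-increment true  (suc r) = trans (cong (_+ + 2) (∑<-increment true r))
  (cong +_ (trans (ℕ.+-comm _ 2) (sym (ℕ.*-suc 2 (suc r)))))
∑<-increment false (suc r) = trans (cong (_+ + 2) (∑<-increment false r))
  (cong +_ (trans (ℕ.+-comm _ 2) (cong suc (sym (ℕ.*-suc 2 r)))))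

∑<-support : ∀ {f g : ℕ → ℤ} {r N} → r < N → (∀ k → k ≤ r → f k ≡ g k) → (∀ k → r < k → f k ≡ 0ℤ) →
             ∑< N f ≡ ∑< (suc r) g
∑<-support {f} {g} {r} {N} r<N low high =
  subst (λ n → ∑< n f ≡ ∑< (suc r) g) (ℕ.m∸n+n≡m r<N) (go (N ∸ suc r))
  where
  go : ∀ d → ∑< (d ℕ.+ suc r) f ≡ ∑< (suc r) g
  go zero    = ∑<-cong (suc r) λ k k≤r → low k (ℕ.≤-pred k≤r)
  go (suc d) = trans (cong₂ _+_ (go d) (high (d ℕ.+ suc r) (ℕ.m≤n+m (suc r) d))) (ℤ.+-identityʳ _)

-- A repeated even part makes every weight 0. Otherwise d is `excludant e r` for some r, the weight
-- for k is 1 if k ≤ r and 0 if k > r, and the increments up to r telescope to d. Parts up to 2N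
-- suffice, because r < N gives d ≤ 2N.
edWeight-expansion : ∀ e N {λs d} → All (0 <_) λs → sum λs < N → Least (Missing e λs) d →
  (if does (noRepeatedEven? λs) then + d else 0ℤ)
    ≡ ∑< N (λ k → increment e k * weight (edWeight e k) (2 ℕ.* N) λs)
edWeight-expansion e N {λs} {d} pos sum<N ((0<d , parity , d∉) , least) with noRepeatedEven? λs
... | no repeated = sym (∑<-zero N λ k _ → trans (cong (increment e k *_) (vanishes k)) (ℤ.*-zeroʳ (increment e k)))
  where
  vanishes : ∀ k → weight (edWeight e k) (2 ℕ.* N) λs ≡ 0ℤ
  vanishes k with find (All.¬All⇒Any¬ (λ p → (2 ∣? p) →-dec (multiplicity p λs ℕ.≤? 1)) λs repeated)
  ... | p , p∈ , bad = weight-zero (edWeight e k) (2 ℕ.* N) (All.lookup pos p∈)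
        (ℕ.≤-trans (∈⇒≤sum p∈) (ℕ.≤-trans (ℕ.<⇒≤ sum<N) (ℕ.m≤m+n N _)))
        (allowed-repeated (2 ∣? p) (does (required? e k p)) even (λ once → bad λ _ → once))
    where
    even : 2 ∣ p
    even = decidable-stable (2 ∣? p) λ odd → bad λ 2∣p → contradiction 2∣p odd
... | yes distinct with excludant-decomposition e d 0<d parity
... | r , refl = sym (trans (∑<-support {g = increment e} r<N low high) (∑<-increment e r))
  where
  -- `excludant e (sum λs)` exceeds every part and is therefore missing, so r ≤ sum λs < N.
  r<N : r < N
  r<N = ℕ.≮⇒≥ λ N<1+r → ℕ.<⇒≱ (excludant-mono-< e (ℕ.<-≤-trans sum<N (ℕ.≤-pred N<1+r)))
    (least (excludant e (sum λs)) (excludant-positive e (sum λs) , excludant-parity e (sum λs) ,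
      λ ∈λs → ℕ.<⇒≱ (excludant> e (sum λs)) (∈⇒≤sum ∈λs)))

  once : ∀ p → 2 ∣ p → multiplicity p λs ≤ 1
  once p 2∣p with p ∈? λs
  ... | yes p∈ = All.lookup distinct p∈ 2∣p
  ... | no p∉  = subst (_≤ 1) (sym (∉⇒multiplicity≡0 p∉)) z≤n

  low : ∀ k → k ≤ r → increment e k * weight (edWeight e k) (2 ℕ.* N) λs ≡ increment e k
  low k k≤r = trans (cong (increment e k *_) (weight-one (edWeight e k) (2 ℕ.* N) λ p 0<p →
                allowed-yes (2 ∣? p) (required? e k p) (once p) λ (p<δ , par) → ∈⇒0<multiplicity
                  (decidable-stable (p ∈? λs) λ p∉ →
                    ℕ.<⇒≱ (ℕ.<-≤-trans p<δ (excludant-mono e k≤r)) (least p (0<p , par , p∉)))))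
              (ℤ.*-identityʳ (increment e k))

  -- For k > r the part d itself is required but absent, and its factor is 0.
  high : ∀ k → r < k → increment e k * weight (edWeight e k) (2 ℕ.* N) λs ≡ 0ℤ
  high k r<k = trans (cong (increment e k *_) (weight-zero (edWeight e k) (2 ℕ.* N) 0<d (excludant≤ e r<N)
      (trans (cong (edWeight e k (excludant e r)) (∉⇒multiplicity≡0 d∉))
             (allowed-missing (2 ∣? excludant e r) (required? e k (excludant e r)) (excludant-mono-< e r<k , parity)))))
    (ℤ.*-zeroʳ (increment e k))

∑-sum : {A : Set} (f : A → ℕ) (xs : List A) → + sum (map f xs) ≡ ∑ xs (λ x → + f x)
∑-sum f []       = refl
∑-sum f (x ∷ xs) = cong (_+_ (+ f x)) (∑-sum f xs)

∑-filter : {A : Set} {P : Pred A 0ℓ} (P? : Decidable P) (f : A → ℤ) (xs : List A) →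
           ∑ (filter P? xs) f ≡ ∑ xs (λ x → if does (P? x) then f x else 0ℤ)
∑-filter P? f []       = refl
∑-filter P? f (x ∷ xs) with does (P? x)
... | true  = cong (_+_ (f x)) (∑-filter P? f xs)
... | false = trans (∑-filter P? f xs) (sym (ℤ.+-identityˡ _))

-- The sums over partitions and over k are interchanged. The bounds N and 2N do not depend on n, so
-- one truncation serves all coefficients below N.
excludant-sum : ∀ e (ex : List ℕ → ℕ) → (∀ λs → Least (Missing e λs) (ex λs)) → ∀ N n → n < N →
  + sum (map ex (𝒫ed n)) ≡ ∑< N (λ k → increment e k * weightedCount (edWeight e k) (2 ℕ.* N) n)
excludant-sum e ex ex-least N n n<N = begin
  + sum (map ex (𝒫ed n))
    ≡⟨ ∑-sum ex (𝒫ed n) ⟩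
  ∑ (𝒫ed n) (λ λs → + ex λs)
    ≡⟨ ∑-filter noRepeatedEven? (λ λs → + ex λs) (partitions n) ⟩
  ∑ (partitions n) (λ λs → if does (noRepeatedEven? λs) then + ex λs else 0ℤ)
    ≡⟨ ∑-cong (partitions n) expansion ⟩
  ∑ (partitions n) (λ λs → ∑< N (λ k → increment e k * weight (edWeight e k) (2 ℕ.* N) λs))
    ≡⟨ ∑-∑< (partitions n) N (λ k λs → increment e k * weight (edWeight e k) (2 ℕ.* N) λs) ⟩
  ∑< N (λ k → ∑ (partitions n) (λ λs → increment e k * weight (edWeight e k) (2 ℕ.* N) λs))
    ≡⟨ ∑<-cong N (λ k _ → trans (∑-scale (increment e k) (partitions n) (weight (edWeight e k) (2 ℕ.* N)))
         (cong (λ xs → increment e k * ∑ xs (weight (edWeight e k) (2 ℕ.* N)))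
               (partitionsWithin-≥ n n ℕ.≤-refl (ℕ.≤-trans (ℕ.<⇒≤ n<N) (ℕ.m≤m+n N _))))) ⟩
  ∑< N (λ k → increment e k * weightedCount (edWeight e k) (2 ℕ.* N) n)
    ∎
  where
  open ≡-Reasoning
  expansion : ∀ {λs} → λs ∈ partitions n → _
  expansion {λs} λs∈ = let _ , pos , total = ∈-partitionsWithin⁻ n n n λs∈ in
    edWeight-expansion e N pos (subst (_< N) (sym total) n<N) (ex-least λs)

-- Generating functions

-- For p > 0, the closed form of the tail ∑ over i ≥ 0 of `allowed e r (j + i)` times q^(ip), as
-- `weightedCount-suc` demands.
factor : Bool → Bool → ℕ → ℕ → Series
factor false false p _             = recip (1-q^ p)
factor false true  p zero          = q ^ p ⊗ recip (1-q^ p)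
factor false true  p (suc _)       = recip (1-q^ p)
factor true  false p zero          = 1+q^ p
factor true  true  p zero          = q ^ p
factor true  _     p (suc zero)    = one
factor true  _     p (suc (suc _)) = const 0ℤ

module _ (K : ℕ) where
  open Mod K
  open Solver using (solve; _:=_; _:+_; _:*_; :-_; con)

  factor-rec≈ : ∀ e r m j → factor e r (suc m) j ≈[ K ] const (allowed e r j) ⊕ q ^ suc m ⊗ factor e r (suc m) (suc j)
  factor-rec≈ e r m j = cases e r j
    where
    x y : Series
    x = q ^ suc m
    y = recip (1-q^ (suc m))

    geometric : y ≈[ K ] one ⊕ x ⊗ y
    geometric = begin
      y                                    ≈⟨ solve 2 (λ x y → y := y :* (con 1ℤ :+ (:- x)) :+ x :* y) ≈-refl x y ⟩
      y ⊗ 1-q^ (suc m) ⊕ x ⊗ y             ≈⟨ ⊕-cong (≈⇒≈[] (recip-inverse (1-q^ (suc m)) (1-q^-constant m))) (≈-refl {x ⊗ y}) ⟩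
      one ⊕ x ⊗ y                          ∎

    vanish : ∀ {c} → c ≈[ K ] c ⊕ x ⊗ const 0ℤ
    vanish {c} = solve 2 (λ c x → c := c :+ x :* con 0ℤ) ≈-refl c x

    shifted : ∀ f → f ≈[ K ] const 0ℤ ⊕ f
    shifted f = solve 1 (λ f → f := con 0ℤ :+ f) ≈-refl f

    shifted-one : x ≈[ K ] const 0ℤ ⊕ x ⊗ one
    shifted-one = solve 1 (λ x → x := con 0ℤ :+ x :* con 1ℤ) ≈-refl x

    cases : ∀ e r j → factor e r (suc m) j ≈[ K ] const (allowed e r j) ⊕ x ⊗ factor e r (suc m) (suc j)
    cases false false _             = geometric
    cases false true  zero          = shifted (x ⊗ y)
    cases false true  (suc _)       = geometric
    cases true  false zero          = ⊕-cong (≈-refl {one}) (≈-sym (≈⇒≈[] (⊗-identityʳ x)))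
    cases true  true  zero          = shifted-one
    cases true  false (suc zero)    = vanish {one}
    cases true  true  (suc zero)    = vanish {one}
    cases true  false (suc (suc _)) = vanish {const 0ℤ}
    cases true  true  (suc (suc _)) = vanish {const 0ℤ}

factor-rec : ∀ e r m j → factor e r (suc m) j ≈ const (allowed e r j) ⊕ q ^ suc m ⊗ factor e r (suc m) (suc j)
factor-rec e r m j n = coeff (factor-rec≈ (suc n) e r m j) n (ℕ.n<1+n n)

2∣k*[1+k] : ∀ k → 2 ∣ k ℕ.* suc k
2∣k*[1+k] zero    = divides 0 refl
2∣k*[1+k] (suc k) = subst (2 ∣_) (sym (expand k)) (∣m∣n⇒∣m+n (2∣k*[1+k] k) (m∣m*n (suc k)))
  where
  expand : ∀ k → suc k ℕ.* suc (suc k) ≡ k ℕ.* suc k ℕ.+ 2 ℕ.* suc k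
  expand = ℕ-Solver.solve-∀

-- 1/(q;q²)_n, (q;q)_n and (-q;q)_n.
R P⁻ P⁺ : ℕ → Series
R  n = ∏< n (λ i → recip (1-q^ (suc (2 ℕ.* i))))
P⁻ n = ∏< n (λ i → 1-q^ (suc i))
P⁺ n = ∏< n (λ i → 1+q^ (suc i))

oddFactor evenFactor : ℕ → ℕ → Series
oddFactor  k i = if does (i ℕ.<? k) then q ^ suc (2 ℕ.* i) else one
evenFactor k i = if does (i ℕ.<? k) then q ^ (2 ℕ.* suc i) else 1+q^ (2 ℕ.* suc i)

edFactor : Bool → ℕ → ℕ → Series
edFactor e k p = factor (does (2 ∣? p)) (does (required? e k p)) p 0

edFactor-odd : ∀ e k i → edFactor e k (suc (2 ℕ.* i)) ≡ factor false (does (required? e k (suc (2 ℕ.* i)))) (suc (2 ℕ.* i)) 0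
edFactor-odd e k i = cong (λ b → factor b (does (required? e k (suc (2 ℕ.* i)))) (suc (2 ℕ.* i)) 0)
  (dec-false (2 ∣? suc (2 ℕ.* i)) (2∤1+2n i))

edFactor-even : ∀ e k i → edFactor e k (2 ℕ.* suc i) ≡ factor true (does (required? e k (2 ℕ.* suc i))) (2 ℕ.* suc i) 0
edFactor-even e k i = cong (λ b → factor b (does (required? e k (2 ℕ.* suc i))) (2 ℕ.* suc i) 0)
  (dec-true (2 ∣? 2 ℕ.* suc i) (m∣m*n (suc i)))

module Assembly (K : ℕ) where
  open Mod K
  open Solver using (solve; _:=_; _:+_; _:*_; :-_; con)
  open QSeries K

  edFactor-optional : ∀ {b} e k p → ¬ (HasParity e p) → factor b (does (required? e k p)) p 0 ≡ factor b false p 0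
  edFactor-optional {b} e k p ¬par = cong (λ r → factor b r p 0) (dec-false (required? e k p) (¬par ∘ proj₂))

  moex-odd : ∀ k i → edFactor false k (suc (2 ℕ.* i)) ≈[ K ] oddFactor k i ⊗ recip (1-q^ (suc (2 ℕ.* i)))
  moex-odd k i = ≈-trans
    (≈-reflexive (trans (edFactor-odd false k i) (cong (λ r → factor false r p 0) (does-⇔ below (required? false k p) (i ℕ.<? k)))))
    (split (does (i ℕ.<? k)))
    where
    p : ℕ
    p = suc (2 ℕ.* i)
    below : (p < suc (2 ℕ.* k) × ¬ (2 ∣ p)) ⇔ i < k
    below = mk⇔ (λ (p<δ , _) → ℕ.*-cancelˡ-< 2 i k (ℕ.≤-pred p<δ)) (λ i<k → s≤s (ℕ.*-monoʳ-< 2 i<k) , 2∤1+2n i)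
    split : ∀ b → factor false b p 0 ≈[ K ] (if b then q ^ p else one) ⊗ recip (1-q^ p)
    split true  = ≈-refl
    split false = solve 1 (λ x → x := con 1ℤ :* x) ≈-refl (recip (1-q^ p))

  meex-even : ∀ k i → edFactor true k (2 ℕ.* suc i) ≈[ K ] evenFactor k i
  meex-even k i = ≈-trans
    (≈-reflexive (trans (edFactor-even true k i) (cong (λ r → factor true r p 0) (does-⇔ below (required? true k p) (i ℕ.<? k)))))
    (split (does (i ℕ.<? k)))
    where
    p : ℕ
    p = 2 ℕ.* suc i
    below : (p < 2 ℕ.* suc k × 2 ∣ p) ⇔ i < k
    below = mk⇔ (λ (p<δ , _) → ℕ.≤-pred (ℕ.*-cancelˡ-< 2 (suc i) (suc k) p<δ)) (λ i<k → ℕ.*-monoʳ-< 2 (s≤s i<k) , m∣m*n (suc i))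
    split : ∀ b → factor true b p 0 ≈[ K ] (if b then q ^ p else 1+q^ p)
    split true  = ≈-refl
    split false = ≈-refl

  weightedCount-pairs : ∀ e k N → weightedCount (edWeight e k) (2 ℕ.* N) ≈[ K ]
    ∏< N (λ i → edFactor e k (suc (2 ℕ.* i)) ⊗ edFactor e k (2 ℕ.* suc i))
  weightedCount-pairs e k N = begin
    weightedCount (edWeight e k) (2 ℕ.* N)
      ≈⟨ weightedCount-∏ K (edWeight e k) (λ m → factor (does (2 ∣? suc m)) (does (required? e k (suc m))) (suc m))
           (λ m j → factor-rec (does (2 ∣? suc m)) (does (required? e k (suc m))) m j) (2 ℕ.* N) ⟩
    ∏< (2 ℕ.* N) (λ m → edFactor e k (suc m))
      ≈⟨ ∏<-double N (λ m → edFactor e k (suc m)) ⟩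
    ∏< N (λ i → edFactor e k (suc (2 ℕ.* i)) ⊗ edFactor e k (suc (suc (2 ℕ.* i))))
      ≈⟨ ∏<-cong N (λ i _ → ⊗-congˡ (edFactor e k (suc (2 ℕ.* i))) (≈-reflexive (cong (edFactor e k) (sym (ℕ.*-suc 2 i))))) ⟩
    ∏< N (λ i → edFactor e k (suc (2 ℕ.* i)) ⊗ edFactor e k (2 ℕ.* suc i))
      ∎

  -- The exponent is 1 + 3 + ... + (2k - 1) = k².
  oddFactor-∏ : ∀ k d → ∏< (d ℕ.+ k) (oddFactor k) ≈[ K ] q ^ (k ℕ.* k)
  oddFactor-∏ k zero = ≈-trans
    (∏<-cong k λ i i<k → ≈-reflexive (cong (λ b → if b then q ^ suc (2 ℕ.* i) else one) (dec-true (i ℕ.<? k) i<k)))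
    (odd-powers k)
    where
    square : ∀ k → k ℕ.* k ℕ.+ suc (2 ℕ.* k) ≡ suc k ℕ.* suc k
    square = ℕ-Solver.solve-∀
    odd-powers : ∀ k → ∏< k (λ i → q ^ suc (2 ℕ.* i)) ≈[ K ] q ^ (k ℕ.* k)
    odd-powers zero    = ≈-refl
    odd-powers (suc k) = ≈-trans (⊗-congʳ (q ^ suc (2 ℕ.* k)) (odd-powers k)) (q^-⊗ {k ℕ.* k} {suc (2 ℕ.* k)} (square k))
  oddFactor-∏ k (suc d) = begin
    ∏< (d ℕ.+ k) (oddFactor k) ⊗ oddFactor k (d ℕ.+ k)
      ≈⟨ ⊗-cong (oddFactor-∏ k d) (≈-reflexive (cong (λ b → if b then q ^ suc (2 ℕ.* (d ℕ.+ k)) else one)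
           (dec-false (d ℕ.+ k ℕ.<? k) (ℕ.≤⇒≯ (ℕ.m≤n+m k d))))) ⟩
    q ^ (k ℕ.* k) ⊗ one
      ≈⟨ ≈⇒≈[] (⊗-identityʳ (q ^ (k ℕ.* k))) ⟩
    q ^ (k ℕ.* k)
      ∎

  -- The required parts give the exponent 2 + 4 + ... + 2k = k(k + 1); the remaining factors form
  -- `E (d + k)` / `E k`, here with the denominator cleared. This denominator becomes that of σ.
  evenFactor-∏ : ∀ k d → ∏< (d ℕ.+ k) (evenFactor k) ⊗ E k ≈[ K ] E (d ℕ.+ k) ⊗ q ^ (k ℕ.* suc k)
  evenFactor-∏ k zero = ≈-trans
    (⊗-congʳ (E k) (≈-trans (∏<-cong k λ i i<k → ≈-reflexive (cong (λ b → if b then q ^ (2 ℕ.* suc i) else 1+q^ (2 ℕ.* suc i)) (dec-true (i ℕ.<? k) i<k)))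
             (even-powers k)))
    (≈⇒≈[] (⊗-comm (q ^ (k ℕ.* suc k)) (E k)))
    where
    pronic : ∀ k → k ℕ.* suc k ℕ.+ 2 ℕ.* suc k ≡ suc k ℕ.* suc (suc k)
    pronic = ℕ-Solver.solve-∀
    even-powers : ∀ k → ∏< k (λ i → q ^ (2 ℕ.* suc i)) ≈[ K ] q ^ (k ℕ.* suc k)
    even-powers zero    = ≈-refl
    even-powers (suc k) = ≈-trans (⊗-congʳ (q ^ (2 ℕ.* suc k)) (even-powers k)) (q^-⊗ {k ℕ.* suc k} {2 ℕ.* suc k} (pronic k))
  evenFactor-∏ k (suc d) = begin
    (C′ ⊗ evenFactor k (d ℕ.+ k)) ⊗ E k
      ≈⟨ ⊗-congʳ (E k) (⊗-congˡ C′ (≈-reflexive (cong (λ b → if b then q ^ (2 ℕ.* suc (d ℕ.+ k)) else x)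
           (dec-false (d ℕ.+ k ℕ.<? k) (ℕ.≤⇒≯ (ℕ.m≤n+m k d)))))) ⟩
    (C′ ⊗ x) ⊗ E k
      ≈⟨ solve 3 (λ c x e → (c :* x) :* e := (c :* e) :* x) ≈-refl C′ x (E k) ⟩
    (C′ ⊗ E k) ⊗ x
      ≈⟨ ⊗-congʳ x (evenFactor-∏ k d) ⟩
    (E (d ℕ.+ k) ⊗ q ^ (k ℕ.* suc k)) ⊗ x
      ≈⟨ solve 3 (λ c y x → (c :* y) :* x := (c :* x) :* y) ≈-refl (E (d ℕ.+ k)) (q ^ (k ℕ.* suc k)) x ⟩
    (E (d ℕ.+ k) ⊗ x) ⊗ q ^ (k ℕ.* suc k)
      ∎
    where
    C′ x : Series
    C′ = ∏< (d ℕ.+ k) (evenFactor k)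
    x = 1+q^ (2 ℕ.* suc (d ℕ.+ k))

  weightedCount-moex : ∀ {k N} → k ≤ N → weightedCount (edWeight false k) (2 ℕ.* N) ≈[ K ] q ^ (k ℕ.* k) ⊗ (R N ⊗ E N)
  weightedCount-moex {k} {N} k≤N = begin
    weightedCount (edWeight false k) (2 ℕ.* N)
      ≈⟨ weightedCount-pairs false k N ⟩
    ∏< N (λ i → edFactor false k (suc (2 ℕ.* i)) ⊗ edFactor false k (2 ℕ.* suc i))
      ≈⟨ ∏<-cong N (λ i _ → ⊗-cong (moex-odd k i) (≈-reflexive (trans (edFactor-even false k i)
           (edFactor-optional {true} false k (2 ℕ.* suc i) λ odd → odd (m∣m*n (suc i)))))) ⟩
    ∏< N (λ i → (oddFactor k i ⊗ ρ i) ⊗ 1+q^ (2 ℕ.* suc i))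
      ≈⟨ ∏<-⊗ N (λ i → oddFactor k i ⊗ ρ i) (λ i → 1+q^ (2 ℕ.* suc i)) ⟩
    ∏< N (λ i → oddFactor k i ⊗ ρ i) ⊗ E N
      ≈⟨ ⊗-congʳ (E N) (∏<-⊗ N (oddFactor k) ρ) ⟩
    (∏< N (oddFactor k) ⊗ R N) ⊗ E N
      ≈⟨ ≈⇒≈[] (⊗-assoc (∏< N (oddFactor k)) (R N) (E N)) ⟩
    ∏< N (oddFactor k) ⊗ (R N ⊗ E N)
      ≈⟨ ⊗-congʳ (R N ⊗ E N) (subst (λ n → ∏< n (oddFactor k) ≈[ K ] q ^ (k ℕ.* k)) (ℕ.m∸n+n≡m k≤N) (oddFactor-∏ k (N ∸ k))) ⟩
    q ^ (k ℕ.* k) ⊗ (R N ⊗ E N)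
      ∎
    where
    ρ : ℕ → Series
    ρ i = recip (1-q^ (suc (2 ℕ.* i)))

  -- Pochhammer symbols as finite products, and Euler's identity

  poch-∏ : ∀ a b n {f} → (∀ i → one ⊕ (⊖ (a ⊗ b ^ i)) ≈[ K ] f i) → ⟨ a ⨾ b ⟩ n ≈[ K ] ∏< n f
  poch-∏ a b zero    p = ≈-refl
  poch-∏ a b (suc n) p = ⊗-cong (poch-∏ a b n p) (p n)

  poch∞-∏ : ∀ a b {f} → a 0 ≡ 0ℤ → b 0 ≡ 0ℤ → (∀ i → one ⊕ (⊖ (a ⊗ b ^ i)) ≈[ K ] f i) → ⟨ a ⨾ b ⟩∞ ≈[ K ] ∏< K f
  poch∞-∏ a b a0 b0 p = ≈-trans
    (mk≈ λ i i<K → sym (proj₂ (⟨⟩∞-converges {a} {b} a0 b0 i) K (ℕ.<⇒≤ i<K)))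
    (poch-∏ a b K p)

  1-cong : ∀ {f g} → f ≈[ K ] g → one ⊕ (⊖ f) ≈[ K ] one ⊕ (⊖ g)
  1-cong p = ⊕-cong (≈-refl {one}) (⊖-cong p)

  1-⊖ : ∀ a b {g} → a ⊗ b ≈[ K ] g → one ⊕ (⊖ ((⊖ a) ⊗ b)) ≈[ K ] one ⊕ g
  1-⊖ a b {g} p = begin
    one ⊕ (⊖ ((⊖ a) ⊗ b))   ≈⟨ solve 2 (λ a b → con 1ℤ :+ (:- ((:- a) :* b)) := con 1ℤ :+ a :* b) ≈-refl a b ⟩
    one ⊕ a ⊗ b             ≈⟨ ⊕-cong (≈-refl {one}) p ⟩
    one ⊕ g                 ∎

  q^m-powers : ∀ m i → q ^ m ⊗ (q ^ m) ^ i ≈[ K ] q ^ (m ℕ.* suc i)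
  q^m-powers m i = ≈-trans (≈⇒≈[] (⊗-comm (q ^ m) ((q ^ m) ^ i))) (≈-sym (^-* q m (suc i)))

  even-poch : ⟨ q ^ 2 ⨾ q ^ 2 ⟩∞ ≈[ K ] D K
  even-poch = poch∞-∏ (q ^ 2) (q ^ 2) refl refl λ i → 1-cong (q^m-powers 2 i)

  even-poch⁺ : ∀ n → ⟨ ⊖ (q ^ 2) ⨾ q ^ 2 ⟩ n ≈[ K ] E n
  even-poch⁺ n = poch-∏ (⊖ (q ^ 2)) (q ^ 2) n λ i → 1-⊖ (q ^ 2) ((q ^ 2) ^ i) (q^m-powers 2 i)

  even-poch⁺∞ : ⟨ ⊖ (q ^ 2) ⨾ q ^ 2 ⟩∞ ≈[ K ] E K
  even-poch⁺∞ = poch∞-∏ (⊖ (q ^ 2)) (q ^ 2) refl refl λ i → 1-⊖ (q ^ 2) ((q ^ 2) ^ i) (q^m-powers 2 i)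

  odd-poch : ⟨ q ⨾ q ^ 2 ⟩∞ ≈[ K ] O K
  odd-poch = poch∞-∏ q (q ^ 2) refl refl λ i → 1-cong
    (≈-trans (≈⇒≈[] (⊗-comm q ((q ^ 2) ^ i))) (⊗-congʳ q (≈-sym (^-* q 2 i))))

  full-poch⁺ : ⟨ ⊖ q ⨾ q ⟩∞ ≈[ K ] P⁺ K
  full-poch⁺ = poch∞-∏ (⊖ q) q refl refl λ i → 1-⊖ q (q ^ i) (≈⇒≈[] (⊗-comm q (q ^ i)))

  difference-of-squares : ∀ a b → a ℕ.+ a ≡ b → 1-q^ a ⊗ 1+q^ a ≈[ K ] 1-q^ b
  difference-of-squares a b 2a≡b = begin
    1-q^ a ⊗ 1+q^ a                ≈⟨ solve 1 (λ x → (con 1ℤ :+ (:- x)) :* (con 1ℤ :+ x) := con 1ℤ :+ (:- (x :* x))) ≈-refl (q ^ a) ⟩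
    one ⊕ (⊖ (q ^ a ⊗ q ^ a))      ≈⟨ 1-cong (q^-⊗ {a} {a} 2a≡b) ⟩
    1-q^ b                         ∎

  -- Factor by factor, 1 - q^(4i) = (1 - q^(2i)) (1 + q^(2i)).
  quadruple-poch : ⟨ q ^ 4 ⨾ q ^ 4 ⟩∞ ≈[ K ] D K ⊗ E K
  quadruple-poch = ≈-trans
    (poch∞-∏ (q ^ 4) (q ^ 4) refl refl λ i → ≈-trans (1-cong (q^m-powers 4 i))
      (≈-sym (difference-of-squares (2 ℕ.* suc i) (4 ℕ.* suc i) (sym (ℕ.*-distribʳ-+ (suc i) 2 2)))))
    (∏<-⊗ K (λ i → 1-q^ (2 ℕ.* suc i)) (λ i → 1+q^ (2 ℕ.* suc i)))

  -- The factors are sorted by parity. Lengthening the product to 2K factors changes nothing modulo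
  -- q^K and leaves exactly K factors of each parity.
  P⁺-split : P⁺ K ≈[ K ] O⁺ K ⊗ E K
  P⁺-split = begin
    P⁺ K            ≈⟨ ∏<-stable (λ i → 1+q^ (suc i)) (λ i K≤i → 1+q^≈1 (ℕ.≤-trans K≤i (ℕ.n≤1+n i))) (ℕ.m≤m+n K (1 ℕ.* K)) ⟨
    P⁺ (2 ℕ.* K)    ≈⟨ ∏<-double K (λ i → 1+q^ (suc i)) ⟩
    ∏< K (λ i → 1+q^ (suc (2 ℕ.* i)) ⊗ 1+q^ (suc (suc (2 ℕ.* i))))
                    ≈⟨ ∏<-cong K (λ i _ → ⊗-congˡ (1+q^ (suc (2 ℕ.* i))) (≈-reflexive (cong 1+q^ (sym (ℕ.*-suc 2 i))))) ⟩
    ∏< K (λ i → 1+q^ (suc (2 ℕ.* i)) ⊗ 1+q^ (2 ℕ.* suc i))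
                    ≈⟨ ∏<-⊗ K (λ i → 1+q^ (suc (2 ℕ.* i))) (λ i → 1+q^ (2 ℕ.* suc i)) ⟩
    O⁺ K ⊗ E K      ∎

  P⁻-split : P⁻ K ≈[ K ] O K ⊗ D K
  P⁻-split = begin
    P⁻ K            ≈⟨ ∏<-stable (λ i → 1-q^ (suc i)) (λ i K≤i → 1-q^≈1 (ℕ.≤-trans K≤i (ℕ.n≤1+n i))) (ℕ.m≤m+n K (1 ℕ.* K)) ⟨
    P⁻ (2 ℕ.* K)    ≈⟨ ∏<-double K (λ i → 1-q^ (suc i)) ⟩
    ∏< K (λ i → 1-q^ (suc (2 ℕ.* i)) ⊗ 1-q^ (suc (suc (2 ℕ.* i))))
                    ≈⟨ ∏<-cong K (λ i _ → ⊗-congˡ (1-q^ (suc (2 ℕ.* i))) (≈-reflexive (cong 1-q^ (sym (ℕ.*-suc 2 i))))) ⟩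
    ∏< K (λ i → 1-q^ (suc (2 ℕ.* i)) ⊗ 1-q^ (2 ℕ.* suc i))
                    ≈⟨ ∏<-⊗ K (λ i → 1-q^ (suc (2 ℕ.* i))) (λ i → 1-q^ (2 ℕ.* suc i)) ⟩
    O K ⊗ D K       ∎

  -- Differences of squares give (q;q)_∞ (-q;q)_∞ = (q²;q²)_∞; splitting (q;q)_∞ by parity exhibits
  -- the same factor (q²;q²)_∞ on the left, and it is cancelled.
  euler : O K ⊗ P⁺ K ≈[ K ] one
  euler = ⊗-cancelʳ (O K ⊗ P⁺ K) (D K) one (D-constant K) (begin
    (O K ⊗ P⁺ K) ⊗ D K      ≈⟨ solve 3 (λ o p d → (o :* p) :* d := (o :* d) :* p) ≈-refl (O K) (P⁺ K) (D K) ⟩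
    (O K ⊗ D K) ⊗ P⁺ K      ≈⟨ ⊗-congʳ (P⁺ K) P⁻-split ⟨
    P⁻ K ⊗ P⁺ K             ≈⟨ ∏<-⊗ K (λ i → 1-q^ (suc i)) (λ i → 1+q^ (suc i)) ⟨
    ∏< K (λ i → 1-q^ (suc i) ⊗ 1+q^ (suc i))
                            ≈⟨ ∏<-cong K (λ i _ → difference-of-squares (suc i) (2 ℕ.* suc i) (cong (suc i ℕ.+_) (sym (ℕ.+-identityʳ (suc i))))) ⟩
    D K                     ≈⟨ solve 1 (λ d → d := con 1ℤ :* d) ≈-refl (D K) ⟩
    one ⊗ D K               ∎)

  R⊗O : ∀ n → R n ⊗ O n ≈[ K ] one
  R⊗O n = begin
    R n ⊗ O n                ≈⟨ ∏<-⊗ n (λ i → recip (1-q^ (suc (2 ℕ.* i)))) (λ i → 1-q^ (suc (2 ℕ.* i))) ⟨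
    ∏< n (λ i → recip (1-q^ (suc (2 ℕ.* i))) ⊗ 1-q^ (suc (2 ℕ.* i)))
                             ≈⟨ ∏<-cong n (λ i _ → ≈⇒≈[] (recip-inverse (1-q^ (suc (2 ℕ.* i))) (1-q^-constant (2 ℕ.* i)))) ⟩
    ∏< n (λ _ → one)         ≈⟨ ones n ⟩
    one                      ∎
    where
    ones : ∀ n → ∏< n (λ _ → one) ≈[ K ] one
    ones zero    = ≈-refl
    ones (suc n) = ≈-trans (≈⇒≈[] (⊗-identityʳ (∏< n (λ _ → one)))) (ones n)

  R≈P⁺ : R K ≈[ K ] P⁺ K
  R≈P⁺ = begin
    R K                      ≈⟨ ≈⇒≈[] (⊗-identityʳ (R K)) ⟨
    R K ⊗ one                ≈⟨ ⊗-congˡ (R K) euler ⟨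
    R K ⊗ (O K ⊗ P⁺ K)       ≈⟨ ≈⇒≈[] (⊗-assoc (R K) (O K) (P⁺ K)) ⟨
    (R K ⊗ O K) ⊗ P⁺ K       ≈⟨ ⊗-congʳ (P⁺ K) (R⊗O K) ⟩
    one ⊗ P⁺ K               ≈⟨ solve 1 (λ d → con 1ℤ :* d := d) ≈-refl (P⁺ K) ⟩
    P⁺ K                     ∎

  -- Summation over k and the two identities

  partialSum-cong : ∀ n {s t} → (∀ k → k < n → s k ≈[ K ] t k) → partialSum s n ≈[ K ] partialSum t n
  partialSum-cong n p = mk≈ λ i i<K → ∑<-cong n λ k k<n → coeff (p k k<n) i i<K

  partialSum-⊗ : ∀ n t c → partialSum (λ k → t k ⊗ c) n ≈[ K ] partialSum t n ⊗ c
  partialSum-⊗ zero    t c = ≈⇒≈[] λ i → sym (∑<-zero (suc i) λ j _ → ℤ.*-zeroˡ (c (i ∸ j)))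
  partialSum-⊗ (suc n) t c = ≈-trans (⊕-cong (partialSum-⊗ n t c) (≈-refl {t n ⊗ c}))
    (≈-sym (≈⇒≈[] (⊗-distribʳ c (partialSum t n) (t n))))

  -- A single K bounds the degrees n < K, the indices k < K and, doubled, the parts.
  excludant-series : ∀ e ex → (∀ λs → Least (Missing e λs) (ex λs)) →
    (λ n → + sum (map ex (𝒫ed n))) ≈[ K ]
    partialSum (λ k → const (increment e k) ⊗ weightedCount (edWeight e k) (2 ℕ.* K)) K
  excludant-series e ex ex-least = mk≈ λ n n<K → trans (excludant-sum e ex ex-least K n n<K)
    (∑<-cong K λ k _ → sym (const-⊗ (increment e k) (weightedCount (edWeight e k) (2 ℕ.* K)) n))

  -- After multiplication by the denominator d e there are two factors o and two factors e; each
  -- pair o e is a p, which leaves d² p³.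
  regroup : ∀ f g d o p e d′ p′ → f ≈[ K ] (d ⊗ (o ⊗ o)) ⊗ (p ⊗ e) → g ≈[ K ] d ⊗ e → p ≈[ K ] o ⊗ e →
            d′ ≈[ K ] d → p′ ≈[ K ] p → f ⊗ g ≈[ K ] d′ ^ 2 ⊗ p′ ^ 3
  regroup f g d o p e d′ p′ f≈ g≈ p≈ d′≈ p′≈ = begin
    f ⊗ g
      ≈⟨ ⊗-cong f≈ g≈ ⟩
    ((d ⊗ (o ⊗ o)) ⊗ (p ⊗ e)) ⊗ (d ⊗ e)
      -- The target is `d ^ 2` times `p ^ 3` unfolded, hence the leading `id`, with two of the three
      -- p still in the form o ∙ e.
      ≈⟨ Monomial.solve 4 (λ d o p e → ((d ∙ (o ∙ o)) ∙ (p ∙ e)) ∙ (d ∙ e) ⊜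
           ((id ∙ d) ∙ d) ∙ (((id ∙ p) ∙ (o ∙ e)) ∙ (o ∙ e))) ≈-refl d o p e ⟩
    ((one ⊗ d) ⊗ d) ⊗ (((one ⊗ p) ⊗ (o ⊗ e)) ⊗ (o ⊗ e))
      ≈⟨ ⊗-congˡ ((one ⊗ d) ⊗ d) (⊗-cong (⊗-congˡ (one ⊗ p) (≈-sym p≈)) (≈-sym p≈)) ⟩
    d ^ 2 ⊗ p ^ 3
      ≈⟨ ⊗-cong (^-cong 2 d′≈) (^-cong 3 p′≈) ⟨
    d′ ^ 2 ⊗ p′ ^ 3
      ∎
    where
    module Monomial = MonoidSolver (CommutativeRing.*-commutativeMonoid (seriesRing K))
    open Monomial using (_⊜_; id) renaming (_⊕_ to _∙_)

  σmoex-series : (λ n → + σmoex n) ≈[ K ] (⟨ q ^ 2 ⨾ q ^ 2 ⟩∞ ^ 2 ⊗ ⟨ ⊖ q ⨾ q ⟩∞ ^ 3) ⊘ ⟨ q ^ 4 ⨾ q ^ 4 ⟩∞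
  σmoex-series = ⊘-unique (λ n → + σmoex n) ⟨ q ^ 4 ⨾ q ^ 4 ⟩∞ (⟨⟩∞-constant (q ^ 4) (q ^ 4))
    (regroup (λ n → + σmoex n) ⟨ q ^ 4 ⨾ q ^ 4 ⟩∞ d o p e ⟨ q ^ 2 ⨾ q ^ 2 ⟩∞ ⟨ ⊖ q ⨾ q ⟩∞
      product quadruple-poch P⁺-split even-poch full-poch⁺)
    where
    d e o p : Series
    d = D K
    e = E K
    o = O⁺ K
    p = P⁺ K

    product : (λ n → + σmoex n) ≈[ K ] (d ⊗ (o ⊗ o)) ⊗ (p ⊗ e)
    product = begin
      (λ n → + σmoex n)
        ≈⟨ excludant-series false moex moex-least ⟩
      partialSum (λ k → const (moexStep k) ⊗ weightedCount (edWeight false k) (2 ℕ.* K)) K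
        ≈⟨ partialSum-cong K (λ k k<K → ≈-trans (⊗-congˡ (const (moexStep k)) (weightedCount-moex (ℕ.<⇒≤ k<K)))
             (≈-sym (≈⇒≈[] (⊗-assoc (const (moexStep k)) (q ^ (k ℕ.* k)) (R K ⊗ e))))) ⟩
      partialSum (λ k → squares k ⊗ (R K ⊗ e)) K
        ≈⟨ partialSum-⊗ K squares (R K ⊗ e) ⟩
      partialSum squares K ⊗ (R K ⊗ e)
        ≈⟨ ⊗-cong (≈-trans (partialSum-stable≈ {squares} squares-Order≥ ℕ.≤-refl) (≈-sym gauss)) (⊗-congʳ e R≈P⁺) ⟩
      (d ⊗ (o ⊗ o)) ⊗ (p ⊗ e)
        ∎

  -- This is `evenFactor-∏` divided by `E k`, which is (-q²;q²)_k. As k(k + 1) is even, the power of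
  -- q is the power of q² with exponent k(k + 1)/2 found in σ(q²).
  evenFactor-σ : ∀ {k} → k ≤ K → ∏< K (evenFactor k) ≈[ K ] E K ⊗ σ-term (q ^ 2) k
  evenFactor-σ {k} k≤K = begin
    ∏< K (evenFactor k)                                 ≈⟨ ⊘-unique (∏< K (evenFactor k)) poch (⟨⟩-constant {⊖ (q ^ 2)} (q ^ 2) refl k) numerator ⟩
    (E K ⊗ (q ^ 2) ^ (k ℕ.* suc k / 2)) ⊗ recip poch    ≈⟨ ≈⇒≈[] (⊗-assoc (E K) ((q ^ 2) ^ (k ℕ.* suc k / 2)) (recip poch)) ⟩
    E K ⊗ σ-term (q ^ 2) k                              ∎
    where
    poch : Series
    poch = ⟨ ⊖ (q ^ 2) ⨾ q ^ 2 ⟩ k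

    numerator : ∏< K (evenFactor k) ⊗ poch ≈[ K ] E K ⊗ (q ^ 2) ^ (k ℕ.* suc k / 2)
    numerator = begin
      ∏< K (evenFactor k) ⊗ poch            ≈⟨ ⊗-congˡ (∏< K (evenFactor k)) (even-poch⁺ k) ⟩
      ∏< K (evenFactor k) ⊗ E k             ≈⟨ subst (λ n → ∏< n (evenFactor k) ⊗ E k ≈[ K ] E n ⊗ q ^ (k ℕ.* suc k)) (ℕ.m∸n+n≡m k≤K) (evenFactor-∏ k (K ∸ k)) ⟩
      E K ⊗ q ^ (k ℕ.* suc k)               ≈⟨ ⊗-congˡ (E K) (≈-trans (≈-reflexive (cong (q ^_) (sym (m*[n/m]≡n (2∣k*[1+k] k))))) (^-* q 2 (k ℕ.* suc k / 2))) ⟩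
      E K ⊗ (q ^ 2) ^ (k ℕ.* suc k / 2)     ∎

  weightedCount-meex : ∀ {k} → k ≤ K → weightedCount (edWeight true k) (2 ℕ.* K) ≈[ K ] σ-term (q ^ 2) k ⊗ (E K ⊗ R K)
  weightedCount-meex {k} k≤K = begin
    weightedCount (edWeight true k) (2 ℕ.* K)
      ≈⟨ weightedCount-pairs true k K ⟩
    ∏< K (λ i → edFactor true k (suc (2 ℕ.* i)) ⊗ edFactor true k (2 ℕ.* suc i))
      ≈⟨ ∏<-cong K (λ i _ → ⊗-cong (≈-reflexive (trans (edFactor-odd true k i)
           (edFactor-optional {false} true k (suc (2 ℕ.* i)) (2∤1+2n i)))) (meex-even k i)) ⟩
    ∏< K (λ i → recip (1-q^ (suc (2 ℕ.* i))) ⊗ evenFactor k i)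
      ≈⟨ ∏<-⊗ K (λ i → recip (1-q^ (suc (2 ℕ.* i)))) (evenFactor k) ⟩
    R K ⊗ ∏< K (evenFactor k)
      ≈⟨ ⊗-congˡ (R K) (evenFactor-σ k≤K) ⟩
    R K ⊗ (E K ⊗ σ-term (q ^ 2) k)
      ≈⟨ solve 3 (λ r e s → r :* (e :* s) := s :* (e :* r)) ≈-refl (R K) (E K) (σ-term (q ^ 2) k) ⟩
    σ-term (q ^ 2) k ⊗ (E K ⊗ R K)
      ∎

  σmeex-series : (λ n → + σmeex n) ≈[ K ] const (+ 2) ⊗ (⟨ ⊖ (q ^ 2) ⨾ q ^ 2 ⟩∞ ⊘ ⟨ q ⨾ q ^ 2 ⟩∞) ⊗ σ (q ^ 2)
  σmeex-series = begin
    (λ n → + σmeex n)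
      ≈⟨ excludant-series true meex meex-least ⟩
    partialSum (λ k → const (+ 2) ⊗ weightedCount (edWeight true k) (2 ℕ.* K)) K
      ≈⟨ partialSum-cong K (λ k k<K → ≈-trans (⊗-congˡ (const (+ 2)) (weightedCount-meex (ℕ.<⇒≤ k<K)))
           (solve 3 (λ c s x → c :* (s :* x) := s :* (c :* x)) ≈-refl (const (+ 2)) (σ-term (q ^ 2) k) (E K ⊗ R K))) ⟩
    partialSum (λ k → σ-term (q ^ 2) k ⊗ (const (+ 2) ⊗ (E K ⊗ R K))) K
      ≈⟨ partialSum-⊗ K (σ-term (q ^ 2)) (const (+ 2) ⊗ (E K ⊗ R K)) ⟩
    partialSum (σ-term (q ^ 2)) K ⊗ (const (+ 2) ⊗ (E K ⊗ R K))
      ≈⟨ ⊗-cong (mk≈ λ i i<K → proj₂ (σ-converges {q ^ 2} refl i) K i<K) (⊗-congˡ (const (+ 2)) quotient) ⟩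
    σ (q ^ 2) ⊗ (const (+ 2) ⊗ (⟨ ⊖ (q ^ 2) ⨾ q ^ 2 ⟩∞ ⊘ ⟨ q ⨾ q ^ 2 ⟩∞))
      ≈⟨ ≈⇒≈[] (⊗-comm (σ (q ^ 2)) (const (+ 2) ⊗ (⟨ ⊖ (q ^ 2) ⨾ q ^ 2 ⟩∞ ⊘ ⟨ q ⨾ q ^ 2 ⟩∞))) ⟩
    const (+ 2) ⊗ (⟨ ⊖ (q ^ 2) ⨾ q ^ 2 ⟩∞ ⊘ ⟨ q ⨾ q ^ 2 ⟩∞) ⊗ σ (q ^ 2)
      ∎
    where
    quotient : E K ⊗ R K ≈[ K ] ⟨ ⊖ (q ^ 2) ⨾ q ^ 2 ⟩∞ ⊘ ⟨ q ⨾ q ^ 2 ⟩∞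
    quotient = ⊘-unique (E K ⊗ R K) ⟨ q ⨾ q ^ 2 ⟩∞ (⟨⟩∞-constant q (q ^ 2)) (begin
      (E K ⊗ R K) ⊗ ⟨ q ⨾ q ^ 2 ⟩∞    ≈⟨ ⊗-congˡ (E K ⊗ R K) odd-poch ⟩
      (E K ⊗ R K) ⊗ O K               ≈⟨ ≈⇒≈[] (⊗-assoc (E K) (R K) (O K)) ⟩
      E K ⊗ (R K ⊗ O K)               ≈⟨ ⊗-congˡ (E K) (R⊗O K) ⟩
      E K ⊗ one                       ≈⟨ ≈⇒≈[] (⊗-identityʳ (E K)) ⟩
      E K                             ≈⟨ even-poch⁺∞ ⟨
      ⟨ ⊖ (q ^ 2) ⨾ q ^ 2 ⟩∞          ∎)

theorem1p12 : ((λ n → + σmoex n) ≈ (⟨ q ^ 2 ⨾ q ^ 2 ⟩∞ ^ 2 ⊗ ⟨ ⊖ q ⨾ q ⟩∞ ^ 3) ⊘ ⟨ q ^ 4 ⨾ q ^ 4 ⟩∞)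
    × ((λ n → + σmeex n) ≈ const (+ 2) ⊗ (⟨ ⊖ (q ^ 2) ⨾ q ^ 2 ⟩∞ ⊘ ⟨ q ⨾ q ^ 2 ⟩∞) ⊗ σ (q ^ 2))
-- The coefficient of q^n is read off modulo q^(n + 1).
theorem1p12 = (λ n → coeff (Assembly.σmoex-series (suc n)) n (ℕ.n<1+n n))
            , (λ n → coeff (Assembly.σmeex-series (suc n)) n (ℕ.n<1+n n))
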